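{- Let $m\ge 3$ and $B\ge 1$ be integers. Online randomized rounding of a fractional solution that preserves the throughput is not feasible for $m$ buffers of size $B$; that is, for every online randomized rounding algorithm RAND there exist an input sequence $\sigma$ and a fractional solution FRAC for $\sigma$ such that the expected throughput of RAND on $(\sigma,\mathrm{FRAC})$ is strictly smaller than the throughput of FRAC on $\sigma$.
   Context: Packet buffering problem (unweighted FIFO buffer management): there are $m$ buffers, each able to store up to $B$ unit-size, unit-value packets; all buffers are initially empty. An input $\sigma$ is a finite sequence of injections: at each integer time $t\ge 0$ an arbitrary (integral, possibly zero) number of packets is injected into each buffer. Packets exceeding the capacity $B$ of a buffer are lost; injection is instantaneous. Then, during the step $(t,t+1)$, an algorithm in the standard (integral) model may transmit a single packet from one non-empty buffer of its choice. After the last injection the algorithm has sufficient time to transmit all packets remaining in its buffers. The throughput is the total number of packets transmitted (its expected value for a randomized algorithm). Fractional solution: it keeps a real load in $[0,B]$ in each buffer. Injecting $p$ packets into a buffer of load $x$ changes the load to $\min(B,x+p)$. In each step it transmits non-negative real amounts from the buffers (at most the current load from each buffer), of total at most 1. Its throughput is the total load transmitted. Online randomized rounding algorithm: a randomized algorithm in the standard integral model which is given, in an online fashion, both the input sequence and a fractional solution for it. Its (random) decision in step $(t,t+1)$ may depend only on the injections up to and including time $t$, on the amounts transmitted by the fractional solution in the steps up to and including $(t,t+1)$, and on its own random bits. The input sequence and the fractional solution do not depend on the outcomes of the random bits of RAND. The rounding preserves the throughput if, for every input sequence and every fractional solution, its expected throughput is at least the throughput of the fractional solution. -}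

module Defs where

open import Data.Fin using (Fin)
open import Data.List using (List; []; _∷_; applyUpTo)
open import Data.Maybe using (Maybe; just; nothing)
open import Data.Nat as ℕ using (ℕ; zero; suc)
import Data.Nat.Properties as ℕₚ
import Data.Integer as ℤ
open import Data.Product using (∃; _×_; _,_)
open import Data.Rational as ℚ using (ℚ; 0ℚ; ½)
import Data.Rational.Properties as ℚₚ
open import Data.Sum using (inj₁; inj₂)
open import Data.Vec as Vec using (Vec; lookup; zipWith; replicate; updateAt)
open import Level using (0ℓ)
open import Relation.Binary.PropositionalEquality
open import Relation.Unary using (Pred; _≐_; ∁; ⋃; U; ∅; _⊥_)

Eventually : (ℕ → Set) → Set
Eventually Q = ∃ λ N → ∀ n → N ℕ.≤ n → Q n

-- Since m and n range symmetrically, the one-sided inequality bounds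
-- ∣ x m - x n ∣ by ε.
Cauchy : (ℕ → ℚ) → Set
Cauchy x = ∀ ε → 0ℚ ℚ.< ε →
  ∃ λ N → ∀ m n → N ℕ.≤ m → N ℕ.≤ n → x m ℚ.≤ x n ℚ.+ ε

record ℝ : Set where
  constructor mkℝ
  field
    seq    : ℕ → ℚ
    cauchy : Cauchy seq

open ℝ

infix  4 _≤ᵣ_ _<ᵣ_ _≃ᵣ_ _⟶_ _≺_
infixl 6 _+ᵣ_ _-ᵣ_
infixl 7 _⊓ᵣ_ _·ᵣ_

_≤ᵣ_ _<ᵣ_ _≃ᵣ_ : ℝ → ℝ → Set
x ≤ᵣ y = ∀ ε → 0ℚ ℚ.< ε → Eventually λ n → seq x n ℚ.≤ seq y n ℚ.+ ε
x <ᵣ y = ∃ λ ε → 0ℚ ℚ.< ε × Eventually λ n → seq x n ℚ.+ ε ℚ.≤ seq y n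
x ≃ᵣ y = x ≤ᵣ y × y ≤ᵣ x

fromℚ : ℚ → ℝ
seq    (fromℚ q) _ = q
cauchy (fromℚ q) ε ε>0 = 0 , λ _ _ _ _ →
  subst (ℚ._≤ q ℚ.+ ε) (ℚₚ.+-identityʳ q) (ℚₚ.+-monoʳ-≤ q (ℚₚ.<⇒≤ ε>0))

fromℕ : ℕ → ℝ
fromℕ n = fromℚ (ℤ.+ n ℚ./ 1)

0ᵣ 1ᵣ : ℝ
0ᵣ = fromℕ 0
1ᵣ = fromℕ 1

private
  half : ℚ → ℚ
  half ε = ½ ℚ.* ε

  half>0 : ∀ ε → 0ℚ ℚ.< ε → 0ℚ ℚ.< half ε
  half>0 ε ε>0 = subst (ℚ._< half ε) (ℚₚ.*-zeroʳ ½) (ℚₚ.*-monoʳ-<-pos ½ ε>0)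

  half+half : ∀ ε → half ε ℚ.+ half ε ≡ ε
  half+half ε = trans (sym (ℚₚ.*-distribʳ-+ ε ½ ½)) (ℚₚ.*-identityˡ ε)

  interchange : ∀ a b c d → (a ℚ.+ b) ℚ.+ (c ℚ.+ d) ≡ (a ℚ.+ c) ℚ.+ (b ℚ.+ d)
  interchange a b c d = begin
    (a ℚ.+ b) ℚ.+ (c ℚ.+ d)  ≡⟨ ℚₚ.+-assoc a b (c ℚ.+ d) ⟩
    a ℚ.+ (b ℚ.+ (c ℚ.+ d))  ≡⟨ cong (a ℚ.+_) (ℚₚ.+-assoc b c d) ⟨
    a ℚ.+ ((b ℚ.+ c) ℚ.+ d)  ≡⟨ cong (λ e → a ℚ.+ (e ℚ.+ d)) (ℚₚ.+-comm b c) ⟩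
    a ℚ.+ ((c ℚ.+ b) ℚ.+ d)  ≡⟨ cong (a ℚ.+_) (ℚₚ.+-assoc c b d) ⟩
    a ℚ.+ (c ℚ.+ (b ℚ.+ d))  ≡⟨ ℚₚ.+-assoc a c (b ℚ.+ d) ⟨
    (a ℚ.+ c) ℚ.+ (b ℚ.+ d)  ∎
    where open ≡-Reasoning

  neg-swap : ∀ a b ε → a ℚ.≤ b ℚ.+ ε → ℚ.- b ℚ.≤ ℚ.- a ℚ.+ ε
  neg-swap a b ε a≤b+ε = begin
    ℚ.- b                          ≡⟨ ℚₚ.+-identityˡ (ℚ.- b) ⟨
    0ℚ ℚ.+ ℚ.- b                   ≡⟨ cong (ℚ._+ ℚ.- b) (ℚₚ.+-inverseˡ a) ⟨
    (ℚ.- a ℚ.+ a) ℚ.+ ℚ.- b        ≤⟨ ℚₚ.+-monoˡ-≤ (ℚ.- b) (ℚₚ.+-monoʳ-≤ (ℚ.- a) a≤b+ε) ⟩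
    (ℚ.- a ℚ.+ (b ℚ.+ ε)) ℚ.- b    ≡⟨ cong (λ e → (ℚ.- a ℚ.+ e) ℚ.- b) (ℚₚ.+-comm b ε) ⟩
    (ℚ.- a ℚ.+ (ε ℚ.+ b)) ℚ.- b    ≡⟨ cong (ℚ._- b) (ℚₚ.+-assoc (ℚ.- a) ε b) ⟨
    ((ℚ.- a ℚ.+ ε) ℚ.+ b) ℚ.- b    ≡⟨ ℚₚ.+-assoc (ℚ.- a ℚ.+ ε) b (ℚ.- b) ⟩
    (ℚ.- a ℚ.+ ε) ℚ.+ (b ℚ.- b)    ≡⟨ cong ((ℚ.- a ℚ.+ ε) ℚ.+_) (ℚₚ.+-inverseʳ b) ⟩
    (ℚ.- a ℚ.+ ε) ℚ.+ 0ℚ           ≡⟨ ℚₚ.+-identityʳ (ℚ.- a ℚ.+ ε) ⟩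
    ℚ.- a ℚ.+ ε                    ∎
    where open ℚₚ.≤-Reasoning

_+ᵣ_ _-ᵣ_ _⊓ᵣ_ : ℝ → ℝ → ℝ
negᵣ : ℝ → ℝ

seq    (x +ᵣ y) n = seq x n ℚ.+ seq y n
cauchy (x +ᵣ y) ε ε>0
  with M , p ← cauchy x (half ε) (half>0 ε ε>0)
     | N , q ← cauchy y (half ε) (half>0 ε ε>0) =
  M ℕ.⊔ N , λ m n m≥ n≥ → begin
    seq x m ℚ.+ seq y m
      ≤⟨ ℚₚ.+-mono-≤
           (p m n (ℕₚ.≤-trans (ℕₚ.m≤m⊔n M N) m≥) (ℕₚ.≤-trans (ℕₚ.m≤m⊔n M N) n≥))
           (q m n (ℕₚ.≤-trans (ℕₚ.m≤n⊔m M N) m≥) (ℕₚ.≤-trans (ℕₚ.m≤n⊔m M N) n≥)) ⟩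
    (seq x n ℚ.+ half ε) ℚ.+ (seq y n ℚ.+ half ε)
      ≡⟨ interchange (seq x n) (half ε) (seq y n) (half ε) ⟩
    (seq x n ℚ.+ seq y n) ℚ.+ (half ε ℚ.+ half ε)
      ≡⟨ cong (seq x n ℚ.+ seq y n ℚ.+_) (half+half ε) ⟩
    (seq x n ℚ.+ seq y n) ℚ.+ ε  ∎
  where open ℚₚ.≤-Reasoning

seq    (negᵣ x) n = ℚ.- seq x n
cauchy (negᵣ x) ε ε>0 with N , p ← cauchy x ε ε>0 =
  N , λ m n m≥ n≥ → neg-swap (seq x n) (seq x m) ε (p n m n≥ m≥)

x -ᵣ y = x +ᵣ negᵣ y

seq    (x ⊓ᵣ y) n = seq x n ℚ.⊓ seq y n
cauchy (x ⊓ᵣ y) ε ε>0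
  with M , p ← cauchy x ε ε>0 | N , q ← cauchy y ε ε>0 =
  M ℕ.⊔ N , close
  where
  open ℚₚ.≤-Reasoning
  close : ∀ m n → M ℕ.⊔ N ℕ.≤ m → M ℕ.⊔ N ℕ.≤ n →
          seq x m ℚ.⊓ seq y m ℚ.≤ seq x n ℚ.⊓ seq y n ℚ.+ ε
  close m n m≥ n≥ with ℚₚ.⊓-sel (seq x n) (seq y n)
  ... | inj₁ eq rewrite eq = ℚₚ.≤-trans (ℚₚ.p⊓q≤p (seq x m) (seq y m))
    (p m n (ℕₚ.≤-trans (ℕₚ.m≤m⊔n M N) m≥) (ℕₚ.≤-trans (ℕₚ.m≤m⊔n M N) n≥))
  ... | inj₂ eq rewrite eq = ℚₚ.≤-trans (ℚₚ.p⊓q≤q (seq x m) (seq y m))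
    (q m n (ℕₚ.≤-trans (ℕₚ.m≤n⊔m M N) m≥) (ℕₚ.≤-trans (ℕₚ.m≤n⊔m M N) n≥))

_·ᵣ_ : ℕ → ℝ → ℝ
zero  ·ᵣ x = 0ᵣ
suc k ·ᵣ x = x +ᵣ k ·ᵣ x

sumᵣ : ∀ {n} → Vec ℝ n → ℝ
sumᵣ = Vec.foldr′ _+ᵣ_ 0ᵣ

Σ< : ℕ → (ℕ → ℝ) → ℝ
Σ< zero    f = 0ᵣ
Σ< (suc n) f = Σ< n f +ᵣ f n

_⟶_ : (ℕ → ℝ) → ℝ → Set
x ⟶ l = ∀ ε → 0ℚ ℚ.< ε →
  Eventually λ n → (x n ≤ᵣ l +ᵣ fromℚ ε) × (l ≤ᵣ x n +ᵣ fromℚ ε)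

-- For nondecreasing sequences: sup x < sup y. It compares total throughputs
-- over unbounded time, a total being the supremum over T of the throughput
-- in the first T steps (for expectations, by monotone convergence).
_≺_ : (ℕ → ℝ) → (ℕ → ℝ) → Set
x ≺ y = ∃ λ c → (∀ n → x n ≤ᵣ c) × (∃ λ n → c <ᵣ y n)

-- ℙ is total for convenience; nothing is assumed about its values on
-- predicates that are not events.
record ProbabilitySpace : Set₁ where
  field
    Ω     : Set
    Event : Pred Ω 0ℓ → Set
    ℙ     : Pred Ω 0ℓ → ℝ

    Event-resp : ∀ {A B} → A ≐ B → Event A → Event B
    Event-U    : Event U
    Event-∁    : ∀ {A} → Event A → Event (∁ A)
    Event-⋃    : ∀ {A : ℕ → Pred Ω 0ℓ} → (∀ n → Event (A n)) → Event (⋃ ℕ A)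

    ℙ-resp   : ∀ {A B} → Event A → A ≐ B → ℙ A ≃ᵣ ℙ B
    ℙ-nonneg : ∀ {A} → Event A → 0ᵣ ≤ᵣ ℙ A
    ℙ-∅      : ℙ ∅ ≃ᵣ 0ᵣ
    ℙ-U      : ℙ U ≃ᵣ 1ᵣ
    ℙ-⋃      : ∀ {A : ℕ → Pred Ω 0ℓ} → (∀ n → Event (A n)) →
               (∀ i j → i ≢ j → A i ⊥ A j) →
               (λ n → Σ< n (λ i → ℙ (A i))) ⟶ ℙ (⋃ ℕ A)

  -- Expectation of a random variable with values in {0, …, N}.
  𝔼 : ℕ → (Ω → ℕ) → ℝ
  𝔼 N X = Σ< (suc N) λ k → k ·ᵣ ℙ (λ ω → X ω ≡ k)

-- Entry number t holds the packets injected at time t; nothing is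
-- injected after the end of the list.
Input : ℕ → Set
Input m = List (Vec ℕ m)

injected : ∀ {m} → Input m → ℕ → Vec ℕ m
injected []      _       = replicate _ 0
injected (p ∷ σ) zero    = p
injected (p ∷ σ) (suc t) = injected σ t

fracInject : ℕ → ℕ → ℝ → ℝ
fracInject B p x = fromℕ B ⊓ᵣ (x +ᵣ fromℕ p)

-- The loads at time t, after the injection and before step (t , t + 1),
-- when s t is the vector of amounts transmitted in step (t , t + 1).
fracLoad : ∀ {m} (B : ℕ) → Input m → (s : ℕ → Vec ℝ m) → ℕ → Vec ℝ m
fracLoad {m} B σ s zero    =
  zipWith (fracInject B) (injected σ 0) (replicate m 0ᵣ)
fracLoad {m} B σ s (suc t) =
  zipWith (fracInject B) (injected σ (suc t)) (zipWith _-ᵣ_ (fracLoad B σ s t) (s t))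

record FractionalSolution {m} (B : ℕ) (σ : Input m) : Set where
  field
    sent        : ℕ → Vec ℝ m
    sent-nonneg : ∀ t i → 0ᵣ ≤ᵣ lookup (sent t) i
    sent≤load   : ∀ t i → lookup (sent t) i ≤ᵣ lookup (fracLoad B σ sent t) i
    sent-total  : ∀ t → sumᵣ (sent t) ≤ᵣ 1ᵣ

  throughput : ℕ → ℝ
  throughput T = Σ< T λ t → sumᵣ (sent t)

open FractionalSolution using (sent)

-- The choice made in one step: a buffer to transmit from, or none.
-- Choosing an empty buffer transmits nothing.
Decision : ℕ → Set
Decision m = Maybe (Fin m)

departures : ∀ {m} → Decision m → Vec ℕ m → ℕ
departures nothing  x = 0
departures (just i) x = lookup x i ℕ.⊓ 1

depart : ∀ {m} → Decision m → Vec ℕ m → Vec ℕ m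
depart nothing  x = x
depart (just i) x = updateAt x i ℕ.pred

inject : ℕ → ℕ → ℕ → ℕ
inject B p x = B ℕ.⊓ (x ℕ.+ p)

-- The integral loads after the injection at time t, when d t is the
-- decision for step (t , t + 1).
load : ∀ {m} (B : ℕ) → Input m → (d : ℕ → Decision m) → ℕ → Vec ℕ m
load {m} B σ d zero    = zipWith (inject B) (injected σ 0) (replicate m 0)
load {m} B σ d (suc t) =
  zipWith (inject B) (injected σ (suc t)) (depart (d t) (load B σ d t))

packets : ∀ {m} (B : ℕ) → Input m → (d : ℕ → Decision m) → ℕ → ℕ
packets B σ d zero    = 0
packets B σ d (suc T) = packets B σ d T ℕ.+ departures (d T) (load B σ d T)

-- Oldest entry first; for the decision of step (t , t + 1) the last entry
-- is the injection at time t and the fractional transmission in that step.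
History : ℕ → Set
History m = List (Vec ℕ m × Vec ℝ m)

history : ∀ {m B} (σ : Input m) → FractionalSolution B σ → ℕ → History m
history σ F t = applyUpTo (λ u → injected σ u , sent F u) (suc t)

-- The point ω plays the role of the random bits. The algorithm's own
-- earlier decisions are functions of ω and of prefixes of the history.
record RoundingAlgorithm (m : ℕ) : Set₁ where
  field
    space : ProbabilitySpace
  open ProbabilitySpace space
  field
    decide       : Ω → History m → Decision m
    decide-event : ∀ h d → Event (λ ω → decide ω h ≡ d)

  run : ∀ {B} (σ : Input m) → FractionalSolution B σ → Ω → ℕ → Decision m
  run σ F ω t = decide ω (history σ F t)

  -- At most one packet leaves per step, so T bounds the random variable.
  expectedThroughput : ∀ {B} (σ : Input m) → FractionalSolution B σ → ℕ → ℝ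
  expectedThroughput {B} σ F T = 𝔼 T λ ω → packets B σ (run σ F ω) T

{-# OPTIONS --safe #-}

{-
All buffers start full. FRAC sends ½ from buffers 0 and 1; one packet then
arrives at buffer a ∈ {0, 1}; FRAC sends ½ from buffers a and 2; one packet then
arrives at buffer k ∈ {0, 1, 2}. FRAC is able to store half of either packet, so
with N = m B it holds N - 1 afterwards, drains this at full speed, is refilled
completely at that moment and sends N more: 2N + 1 in as many steps.

An integral algorithm whose first decision is not a and whose first two decisions
are not k finds both buffers full and loses both packets. It then sends at most N
before the final refill and at most 2N altogether, whereas no algorithm exceeds
2N + 1. The first decision is independent of a and k and the second one of k, and
every pair of decisions is of this kind for one of the six choices of (a , k).
Some choice therefore has probability at least 1/8 of being bad (1/6, up to the
precision to which probabilities can be compared constructively), so that the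
expected throughput is at most 2N + 7/8.
-}

module Submission where

import Algebra.Properties.CommutativeSemigroup as CommutativeSemigroupProperties
open import Algebra.Bundles using (CommutativeMonoid)
open import Data.Empty using (⊥-elim)
open import Data.Fin as Fin using (Fin; zero; suc; toℕ; _↑ˡ_)
import Data.Fin.Properties as Finₚ
import Data.Integer as ℤ
import Data.Integer.Properties as ℤₚ
open import Data.List as List using ([]; _∷_; _++_)
open import Data.Maybe using (just; nothing)
import Data.Maybe.Properties as Maybeₚ
open import Data.Nat as ℕ using (ℕ; zero; suc; z≤n; s≤s; _≤_)
import Data.Nat.Coprimality as Coprimality
import Data.Nat.Properties as ℕₚ
open import Data.Product using (∃; ∃₂; _×_; _,_; proj₁; proj₂)
open import Data.Rational as ℚ using (ℚ; 0ℚ; 1ℚ; ½)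
import Data.Rational.Properties as ℚₚ
open import Data.Sum using (_⊎_; inj₁; inj₂)
open import Data.Unit using (tt)
open import Data.Vec using (Vec; []; _∷_; lookup; zipWith; replicate; updateAt; sum; map)
import Data.Vec.Properties as Vecₚ
open import Function using (_∘_)
open import Level using (0ℓ)
open import Relation.Binary.PropositionalEquality
open import Relation.Nullary using (¬_; Dec; yes; no)
open import Relation.Nullary.Decidable using (decidable-stable; from-yes; ¬?)
open import Relation.Unary using (Pred; Decidable; _∩_; ∁; ⋃; U; ∅; _⊥_)
open import Defs
open ℝ

-- Real numbers

module ℚ+ = CommutativeSemigroupProperties
  (CommutativeMonoid.commutativeSemigroup ℚₚ.+-0-commutativeMonoid)

½*-pos : ∀ {ε} → 0ℚ ℚ.< ε → 0ℚ ℚ.< ½ ℚ.* ε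
½*-pos {ε} ε>0 = subst (ℚ._< ½ ℚ.* ε) (ℚₚ.*-zeroʳ ½) (ℚₚ.*-monoʳ-<-pos ½ ε>0)

½*-double : ∀ ε → ½ ℚ.* ε ℚ.+ ½ ℚ.* ε ≡ ε
½*-double ε = trans (sym (ℚₚ.*-distribʳ-+ ε ½ ½)) (ℚₚ.*-identityˡ ε)

p≤p+ε : ∀ p {ε} → 0ℚ ℚ.< ε → p ℚ.≤ p ℚ.+ ε
p≤p+ε p {ε} ε>0 = subst (ℚ._≤ p ℚ.+ ε) (ℚₚ.+-identityʳ p) (ℚₚ.+-monoʳ-≤ p (ℚₚ.<⇒≤ ε>0))

pointwise⇒≤ᵣ : ∀ x y → (∀ n → seq x n ℚ.≤ seq y n) → x ≤ᵣ y
pointwise⇒≤ᵣ x y x≤y ε ε>0 = 0 , λ n _ → ℚₚ.≤-trans (x≤y n) (p≤p+ε _ ε>0)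

pointwise⇒≃ᵣ : ∀ x y → (∀ n → seq x n ≡ seq y n) → x ≃ᵣ y
pointwise⇒≃ᵣ x y x≡y = pointwise⇒≤ᵣ x y (λ n → ℚₚ.≤-reflexive (x≡y n)) ,
                       pointwise⇒≤ᵣ y x (λ n → ℚₚ.≤-reflexive (sym (x≡y n)))

≤ᵣ-refl : ∀ x → x ≤ᵣ x
≤ᵣ-refl x = pointwise⇒≤ᵣ x x λ _ → ℚₚ.≤-refl

≤ᵣ-approx : ∀ x y → (∀ ε → 0ℚ ℚ.< ε → x ≤ᵣ y +ᵣ fromℚ ε) → x ≤ᵣ y
≤ᵣ-approx x y x≤y+ ε ε>0
  with N , p ← x≤y+ (½ ℚ.* ε) (½*-pos ε>0) (½ ℚ.* ε) (½*-pos ε>0) =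
  N , λ n n≥ → subst (seq x n ℚ.≤_)
    (trans (ℚₚ.+-assoc (seq y n) _ _) (cong (seq y n ℚ.+_) (½*-double ε))) (p n n≥)

+ᵣ-mono-≤ : ∀ x y u v → x ≤ᵣ y → u ≤ᵣ v → x +ᵣ u ≤ᵣ y +ᵣ v
+ᵣ-mono-≤ x y u v x≤y u≤v ε ε>0
  with M , p ← x≤y (½ ℚ.* ε) (½*-pos ε>0) | N , q ← u≤v (½ ℚ.* ε) (½*-pos ε>0) =
  M ℕ.⊔ N , λ n n≥ → subst (seq x n ℚ.+ seq u n ℚ.≤_)
    (trans (ℚ+.interchange (seq y n) _ (seq v n) _)
           (cong (seq y n ℚ.+ seq v n ℚ.+_) (½*-double ε)))
    (ℚₚ.+-mono-≤ (p n (ℕₚ.m⊔n≤o⇒m≤o M N n≥)) (q n (ℕₚ.m⊔n≤o⇒n≤o M N n≥)))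

≤ᵣ-trans : ∀ x y z → x ≤ᵣ y → y ≤ᵣ z → x ≤ᵣ z
≤ᵣ-trans x y z x≤y y≤z ε ε>0
  with M , p ← x≤y (½ ℚ.* ε) (½*-pos ε>0) | N , q ← y≤z (½ ℚ.* ε) (½*-pos ε>0) =
  M ℕ.⊔ N , λ n n≥ → subst (seq x n ℚ.≤_)
    (trans (ℚₚ.+-assoc (seq z n) _ _) (cong (seq z n ℚ.+_) (½*-double ε)))
    (ℚₚ.≤-trans (p n (ℕₚ.m⊔n≤o⇒m≤o M N n≥))
                (ℚₚ.+-monoˡ-≤ (½ ℚ.* ε) (q n (ℕₚ.m⊔n≤o⇒n≤o M N n≥))))

·ᵣ-monoʳ-≤ : ∀ k x y → x ≤ᵣ y → k ·ᵣ x ≤ᵣ k ·ᵣ y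
·ᵣ-monoʳ-≤ zero    x y x≤y = ≤ᵣ-refl 0ᵣ
·ᵣ-monoʳ-≤ (suc k) x y x≤y = +ᵣ-mono-≤ x y (k ·ᵣ x) (k ·ᵣ y) x≤y (·ᵣ-monoʳ-≤ k x y x≤y)

·ᵣ-zeroʳ : ∀ k n → seq (k ·ᵣ 0ᵣ) n ≡ 0ℚ
·ᵣ-zeroʳ zero    n = refl
·ᵣ-zeroʳ (suc k) n = trans (ℚₚ.+-identityˡ _) (·ᵣ-zeroʳ k n)

·ᵣ-nonneg : ∀ k x → 0ᵣ ≤ᵣ x → 0ᵣ ≤ᵣ k ·ᵣ x
·ᵣ-nonneg k x x≥0 = ≤ᵣ-trans 0ᵣ (k ·ᵣ 0ᵣ) (k ·ᵣ x)
  (pointwise⇒≤ᵣ 0ᵣ (k ·ᵣ 0ᵣ) λ n → ℚₚ.≤-reflexive (sym (·ᵣ-zeroʳ k n)))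
  (·ᵣ-monoʳ-≤ k 0ᵣ x x≥0)

·ᵣ-nonpos : ∀ k x → x ≤ᵣ 0ᵣ → k ·ᵣ x ≤ᵣ 0ᵣ
·ᵣ-nonpos k x x≤0 = ≤ᵣ-trans (k ·ᵣ x) (k ·ᵣ 0ᵣ) 0ᵣ
  (·ᵣ-monoʳ-≤ k x 0ᵣ x≤0)
  (pointwise⇒≤ᵣ (k ·ᵣ 0ᵣ) 0ᵣ λ n → ℚₚ.≤-reflexive (·ᵣ-zeroʳ k n))

·ᵣ-monoˡ-≤ : ∀ {j k} x → 0ᵣ ≤ᵣ x → j ℕ.≤ k → j ·ᵣ x ≤ᵣ k ·ᵣ x
·ᵣ-monoˡ-≤ {k = k} x x≥0 z≤n = ·ᵣ-nonneg k x x≥0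
·ᵣ-monoˡ-≤ {suc j} {suc k} x x≥0 (s≤s j≤k) =
  +ᵣ-mono-≤ x x (j ·ᵣ x) (k ·ᵣ x) (≤ᵣ-refl x) (·ᵣ-monoˡ-≤ x x≥0 j≤k)

·ᵣ-distribˡ-+ᵣ : ∀ k x y n → seq (k ·ᵣ (x +ᵣ y)) n ≡ seq (k ·ᵣ x +ᵣ k ·ᵣ y) n
·ᵣ-distribˡ-+ᵣ zero    x y n = refl
·ᵣ-distribˡ-+ᵣ (suc k) x y n = trans
  (cong (seq x n ℚ.+ seq y n ℚ.+_) (·ᵣ-distribˡ-+ᵣ k x y n))
  (ℚ+.interchange (seq x n) (seq y n) (seq (k ·ᵣ x) n) (seq (k ·ᵣ y) n))

x≤x+nonneg : ∀ x y → 0ᵣ ≤ᵣ y → x ≤ᵣ x +ᵣ y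
x≤x+nonneg x y y≥0 = ≤ᵣ-trans x (x +ᵣ 0ᵣ) (x +ᵣ y)
  (pointwise⇒≤ᵣ x (x +ᵣ 0ᵣ) λ n → ℚₚ.≤-reflexive (sym (ℚₚ.+-identityʳ _)))
  (+ᵣ-mono-≤ x x 0ᵣ y (≤ᵣ-refl x) y≥0)

x+nonpos≤x : ∀ x y → y ≤ᵣ 0ᵣ → x +ᵣ y ≤ᵣ x
x+nonpos≤x x y y≤0 = ≤ᵣ-trans (x +ᵣ y) (x +ᵣ 0ᵣ) x
  (+ᵣ-mono-≤ x x y 0ᵣ (≤ᵣ-refl x) y≤0)
  (pointwise⇒≤ᵣ (x +ᵣ 0ᵣ) x λ n → ℚₚ.≤-reflexive (ℚₚ.+-identityʳ _))

Σ<-mono-≤ : ∀ p {M N} → (∀ i → 0ᵣ ≤ᵣ p i) → M ℕ.≤ N → Σ< M p ≤ᵣ Σ< N p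
Σ<-mono-≤ p {M} p≥0 M≤N = go (ℕₚ.≤⇒≤′ M≤N)
  where
  go : ∀ {N} → M ℕ.≤′ N → Σ< M p ≤ᵣ Σ< N p
  go ℕ.≤′-refl            = ≤ᵣ-refl (Σ< M p)
  go (ℕ.≤′-step {N} M≤′N) = ≤ᵣ-trans (Σ< M p) (Σ< N p) (Σ< N p +ᵣ p N)
    (go M≤′N) (x≤x+nonneg (Σ< N p) (p N) (p≥0 N))

-- Null terms from index `M` on cannot lift a partial sum above `Σ< M p`. This turns the limit in
-- countable additivity into a bound by a finite sum.
Σ<-truncate : ∀ p M N → (∀ i → 0ᵣ ≤ᵣ p i) → (∀ i → M ℕ.≤ i → p i ≤ᵣ 0ᵣ) → Σ< N p ≤ᵣ Σ< M p
Σ<-truncate p M zero    p≥0 p≤0 = Σ<-mono-≤ p {N = M} p≥0 z≤n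
Σ<-truncate p M (suc N) p≥0 p≤0 with M ℕ.≤? N
... | yes M≤N = ≤ᵣ-trans (Σ< N p +ᵣ p N) (Σ< N p) (Σ< M p)
  (x+nonpos≤x (Σ< N p) (p N) (p≤0 N M≤N)) (Σ<-truncate p M N p≥0 p≤0)
... | no  M≰N = Σ<-mono-≤ p p≥0 (ℕₚ.≰⇒> M≰N)

monotone⇒≤limit : ∀ x l → (∀ {m n} → m ℕ.≤ n → x m ≤ᵣ x n) → x ⟶ l → ∀ n → x n ≤ᵣ l
monotone⇒≤limit x l mono x⟶l n = ≤ᵣ-approx (x n) l λ ε ε>0 →
  let N , p = x⟶l ε ε>0
  in ≤ᵣ-trans (x n) (x (n ℕ.⊔ N)) (l +ᵣ fromℚ ε)
       (mono (ℕₚ.m≤m⊔n n N)) (proj₁ (p (n ℕ.⊔ N) (ℕₚ.m≤n⊔m n N)))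

bounded⇒limit≤ : ∀ x l u → (∀ n → x n ≤ᵣ u) → x ⟶ l → l ≤ᵣ u
bounded⇒limit≤ x l u x≤u x⟶l = ≤ᵣ-approx l u λ ε ε>0 →
  let N , p = x⟶l ε ε>0
  in ≤ᵣ-trans l (x N +ᵣ fromℚ ε) (u +ᵣ fromℚ ε)
       (proj₂ (p N ℕₚ.≤-refl))
       (+ᵣ-mono-≤ (x N) u (fromℚ ε) (fromℚ ε) (x≤u N) (≤ᵣ-refl (fromℚ ε)))

ℚ-+-cancelʳ-≤ : ∀ r p q → p ℚ.+ r ℚ.≤ q ℚ.+ r → p ℚ.≤ q
ℚ-+-cancelʳ-≤ r p q p+r≤q+r = ℚₚ.≮⇒≥ λ q<p → ℚₚ.<-irrefl refl (ℚₚ.<-≤-trans (ℚₚ.+-monoˡ-< r q<p) p+r≤q+r)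

-- The order of the reals is undecidable, so the two alternatives overlap by `2η`. From index `N` on
-- the sequence stays within `η` of the rational `seq x N`, and comparing that one with `r + η`
-- decides.
≤ᵣ-dichotomy : ∀ x r η → 0ℚ ℚ.< η → fromℚ r ≤ᵣ x ⊎ x ≤ᵣ fromℚ (r ℚ.+ (η ℚ.+ η))
≤ᵣ-dichotomy x r η η>0 with N , close ← cauchy x η η>0 with r ℚ.+ η ℚ.≤? seq x N
... | yes r+η≤x = inj₁ λ ε ε>0 → N , λ n n≥ →
  ℚₚ.≤-trans (ℚ-+-cancelʳ-≤ η r (seq x n)
    (ℚₚ.≤-trans r+η≤x (close N n ℕₚ.≤-refl n≥))) (p≤p+ε _ ε>0)
... | no  r+η≰x = inj₂ λ ε ε>0 → N , λ n n≥ →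
  ℚₚ.≤-trans (close n N n≥ ℕₚ.≤-refl) (ℚₚ.≤-trans
    (ℚₚ.≤-trans (ℚₚ.+-monoˡ-≤ η (ℚₚ.<⇒≤ (ℚₚ.≰⇒> r+η≰x)))
                (ℚₚ.≤-reflexive (ℚₚ.+-assoc r η η)))
    (p≤p+ε _ ε>0))

-- The pigeonhole principle, approximate because each summand is tested against `r` with the slack
-- of `≤ᵣ-dichotomy`.
large-summand : ∀ p n r η → 0ℚ ℚ.< η →
  (∃ λ i → i ℕ.< n × fromℚ r ≤ᵣ p i) ⊎ Σ< n p ≤ᵣ n ·ᵣ fromℚ (r ℚ.+ (η ℚ.+ η))
large-summand p zero    r η η>0 = inj₂ (≤ᵣ-refl 0ᵣ)
large-summand p (suc n) r η η>0 with large-summand p n r η η>0 | ≤ᵣ-dichotomy (p n) r η η>0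
... | inj₁ (i , i<n , r≤p) | _        = inj₁ (i , ℕₚ.m≤n⇒m≤1+n i<n , r≤p)
... | inj₂ Σ≤              | inj₁ r≤p = inj₁ (n , ℕₚ.≤-refl , r≤p)
... | inj₂ Σ≤              | inj₂ p≤  = inj₂
  (≤ᵣ-trans (Σ< n p +ᵣ p n) (n ·ᵣ s +ᵣ s) (s +ᵣ n ·ᵣ s)
    (+ᵣ-mono-≤ (Σ< n p) (n ·ᵣ s) (p n) s Σ≤ p≤)
    (pointwise⇒≤ᵣ (n ·ᵣ s +ᵣ s) (s +ᵣ n ·ᵣ s) λ i → ℚₚ.≤-reflexive (ℚₚ.+-comm (seq (n ·ᵣ s) i) (seq s i))))
  where
  s : ℝ
  s = fromℚ (r ℚ.+ (η ℚ.+ η))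

≤ᵣ⇒≯ᵣ : ∀ x y → x ≤ᵣ y → ¬ y <ᵣ x
≤ᵣ⇒≯ᵣ x y x≤y (ε , ε>0 , N , q) with M , p ← x≤y (½ ℚ.* ε) (½*-pos ε>0) =
  ℚₚ.<-irrefl refl (ℚₚ.<-≤-trans strict (ℚₚ.≤-trans (q n (ℕₚ.m≤n⊔m M N)) (p n (ℕₚ.m≤m⊔n M N))))
  where
  n : ℕ
  n = M ℕ.⊔ N

  strict : seq y n ℚ.+ ½ ℚ.* ε ℚ.< seq y n ℚ.+ ε
  strict = ℚₚ.+-monoʳ-< (seq y n) (subst₂ ℚ._<_ (ℚₚ.+-identityʳ _) (½*-double ε)
    (ℚₚ.+-monoʳ-< (½ ℚ.* ε) (½*-pos ε>0)))

≤ᵣ-minus : ∀ x y r s → fromℚ r ≤ᵣ y → x +ᵣ y ≤ᵣ fromℚ s → x ≤ᵣ fromℚ (s ℚ.- r)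
≤ᵣ-minus x y r s r≤y x+y≤s = ≤ᵣ-trans x ((x +ᵣ fromℚ r) -ᵣ fromℚ r) (fromℚ (s ℚ.- r))
  (pointwise⇒≤ᵣ x ((x +ᵣ fromℚ r) -ᵣ fromℚ r) λ n → ℚₚ.≤-reflexive (sym (trans
    (ℚₚ.+-assoc (seq x n) r (ℚ.- r))
    (trans (cong (seq x n ℚ.+_) (ℚₚ.+-inverseʳ r)) (ℚₚ.+-identityʳ (seq x n))))))
  (+ᵣ-mono-≤ (x +ᵣ fromℚ r) (fromℚ s) (fromℚ (ℚ.- r)) (fromℚ (ℚ.- r))
    (≤ᵣ-trans (x +ᵣ fromℚ r) (x +ᵣ y) (fromℚ s)
      (+ᵣ-mono-≤ x x (fromℚ r) y (≤ᵣ-refl x) r≤y) x+y≤s)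
    (≤ᵣ-refl (fromℚ (ℚ.- r))))

-- Probability

module Probability (S : ProbabilitySpace) where
  open ProbabilitySpace S

  Event-∅ : Event ∅
  Event-∅ = Event-resp ((λ ¬u → ¬u tt) , λ ()) (Event-∁ Event-U)

  -- De Morgan: the intersection is the complement of the countable union of `∁ A`, `∁ B`, `∁ B`,
  -- and so on. Decidability removes the double negations that arise.
  Event-∩ : ∀ {A B} → Decidable A → Decidable B → Event A → Event B → Event (A ∩ B)
  Event-∩ {A} {B} A? B? EA EB = Event-resp
    ( (λ {ω} ¬⋃ → decidable-stable (A? ω) (λ ¬a → ¬⋃ (0 , ¬a)) ,
                  decidable-stable (B? ω) (λ ¬b → ¬⋃ (1 , ¬b)))
    , λ { (a , b) (zero , ¬a) → ¬a a ; (a , b) (suc _ , ¬b) → ¬b b })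
    (Event-∁ (Event-⋃ {A = complements} λ { zero → Event-∁ EA ; (suc _) → Event-∁ EB }))
    where
    complements : ℕ → Pred Ω 0ℓ
    complements zero    = ∁ A
    complements (suc _) = ∁ B

  module _ (A : ℕ → Pred Ω 0ℓ) (event : ∀ n → Event (A n))
           (disjoint : ∀ i j → i ≢ j → A i ⊥ A j) (exhaustive : ∀ ω → ∃ λ n → A n ω) where

    private
      p : ℕ → ℝ
      p i = ℙ (A i)

      ⋃≃1 : ℙ (⋃ ℕ A) ≃ᵣ 1ᵣ
      ⋃≃1 with ℙ-resp {B = U} (Event-⋃ event) ((λ _ → tt) , λ {ω} _ → exhaustive ω) | ℙ-U
      ... | l , g | l′ , g′ = ≤ᵣ-trans (ℙ (⋃ ℕ A)) (ℙ U) 1ᵣ l l′ , ≤ᵣ-trans 1ᵣ (ℙ U) (ℙ (⋃ ℕ A)) g′ g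

    partition-≤1 : ∀ n → Σ< n p ≤ᵣ 1ᵣ
    partition-≤1 n = ≤ᵣ-trans (Σ< n p) (ℙ (⋃ ℕ A)) 1ᵣ
      (monotone⇒≤limit (λ n → Σ< n p) (ℙ (⋃ ℕ A))
        (Σ<-mono-≤ p λ i → ℙ-nonneg (event i)) (ℙ-⋃ event disjoint) n)
      (proj₁ ⋃≃1)

    partition-≥1 : ∀ N → (∀ i → N ℕ.≤ i → ℙ (A i) ≤ᵣ 0ᵣ) → 1ᵣ ≤ᵣ Σ< N p
    partition-≥1 N null = ≤ᵣ-trans 1ᵣ (ℙ (⋃ ℕ A)) (Σ< N p)
      (proj₂ ⋃≃1)
      (bounded⇒limit≤ (λ n → Σ< n p) (ℙ (⋃ ℕ A)) (Σ< N p)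
        (λ n → Σ<-truncate p N n (λ i → ℙ-nonneg (event i)) null) (ℙ-⋃ event disjoint))

  impossible⇒null : ∀ {A} → (∀ ω → ¬ A ω) → ℙ A ≤ᵣ 0ᵣ
  impossible⇒null {A} ¬A = ≤ᵣ-trans (ℙ A) (ℙ ∅) 0ᵣ
    (proj₂ (ℙ-resp Event-∅ ((λ ()) , λ {ω} a → ¬A ω a))) (proj₁ ℙ-∅)

  -- Additivity is given for infinite sequences, so `A` and `B` are completed to a countable
  -- partition of `Ω` by `∁ A ∩ ∁ B` and empty events.
  disjoint-+≤1 : ∀ {A B} → Decidable A → Decidable B → Event A → Event B → A ⊥ B →
                 ℙ A +ᵣ ℙ B ≤ᵣ 1ᵣ
  disjoint-+≤1 {A} {B} A? B? EA EB A⊥B =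
    ≤ᵣ-trans (ℙ A +ᵣ ℙ B) (Σ< 2 λ i → ℙ (parts i)) 1ᵣ
      (proj₁ (pointwise⇒≃ᵣ (ℙ A +ᵣ ℙ B) (Σ< 2 λ i → ℙ (parts i))
        λ n → cong (ℚ._+ seq (ℙ B) n) (sym (ℚₚ.+-identityˡ (seq (ℙ A) n)))))
      (partition-≤1 parts events disjoint exhaustive 2)
    where
    parts : ℕ → Pred Ω 0ℓ
    parts 0 = A
    parts 1 = B
    parts 2 = ∁ A ∩ ∁ B
    parts (suc (suc (suc _))) = ∅

    events : ∀ n → Event (parts n)
    events 0 = EA
    events 1 = EB
    events 2 = Event-∩ (¬? ∘ A?) (¬? ∘ B?) (Event-∁ EA) (Event-∁ EB)
    events (suc (suc (suc _))) = Event-∅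

    disjoint : ∀ i j → i ≢ j → parts i ⊥ parts j
    disjoint 0 0 i≢j _ = i≢j refl
    disjoint 0 1 _ ab = A⊥B ab
    disjoint 0 2 _ (a , ¬a , _) = ¬a a
    disjoint 1 0 _ (b , a) = A⊥B (a , b)
    disjoint 1 1 i≢j _ = i≢j refl
    disjoint 1 2 _ (b , _ , ¬b) = ¬b b
    disjoint 2 0 _ ((¬a , _) , a) = ¬a a
    disjoint 2 1 _ ((_ , ¬b) , b) = ¬b b
    disjoint 2 2 i≢j _ = i≢j refl

    exhaustive : ∀ ω → ∃ λ n → parts n ω
    exhaustive ω with A? ω | B? ω
    ... | yes a | _     = 0 , a
    ... | no ¬a | yes b = 1 , b
    ... | no ¬a | no ¬b = 2 , ¬a , ¬b

  -- Asking for all decidable predicates instead of single values closes the notion under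
  -- composition with arbitrary functions `g`, since `Q ∘ g` is again decidable.
  Measurable : {A : Set} → (Ω → A) → Set₁
  Measurable {A} X = ∀ {Q : Pred A 0ℓ} → Decidable Q → Event (Q ∘ X)

  measurable-const : ∀ {A : Set} (a : A) → Measurable (λ _ → a)
  measurable-const a Q? with Q? a
  ... | yes q = Event-resp ((λ _ → q) , λ _ → tt) Event-U
  ... | no ¬q = Event-resp ((λ ()) , ¬q) Event-∅

  -- The event splits along the values of `X` into a countable union of intersections of
  -- `X ω ≡ enum n` with `Q (enum n , Y ω)`, which is why the first component is enumerated.
  measurable-, : ∀ {A C : Set} {X : Ω → A} {Y : Ω → C} →
    (∀ a b → Dec (a ≡ b)) → (enum : ℕ → A) → (∀ a → ∃ λ n → enum n ≡ a) →
    (∀ a → Event (λ ω → X ω ≡ a)) → Measurable Y → Measurable (λ ω → X ω , Y ω)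
  measurable-, {X = X} {Y} _≟_ enum onto EX EY {Q} Q? = Event-resp
    ( (λ { {ω} (n , eq , q) → subst (λ a → Q (a , Y ω)) (sym eq) q })
    , λ {ω} q → let n , eq = onto (X ω) in
                n , sym eq , subst (λ a → Q (a , Y ω)) (sym eq) q )
    (Event-⋃ λ n → Event-∩ (λ ω → X ω ≟ enum n) (λ ω → Q? (enum n , Y ω))
                     (EX (enum n)) (EY λ c → Q? (enum n , c)))

  module _ {f : Ω → ℕ} (f-measurable : Measurable f) where

    private
      p : ℕ → ℝ
      p i = ℙ λ ω → f ω ≡ i

      event : ∀ i → Event λ ω → f ω ≡ i
      event i = f-measurable (ℕ._≟ i)

      p≥0 : ∀ i → 0ᵣ ≤ᵣ p i
      p≥0 i = ℙ-nonneg (event i)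

    law-≤1 : ∀ n → Σ< n p ≤ᵣ 1ᵣ
    law-≤1 = partition-≤1 (λ i ω → f ω ≡ i) event
      (λ i j i≢j (eq , eq′) → i≢j (trans (sym eq) eq′)) (λ ω → f ω , refl)

    law-≥1 : ∀ N → (∀ ω → f ω ℕ.< N) → 1ᵣ ≤ᵣ Σ< N p
    law-≥1 N f<N = partition-≥1 (λ i ω → f ω ≡ i) event
      (λ i j i≢j (eq , eq′) → i≢j (trans (sym eq) eq′)) (λ ω → f ω , refl) N
      λ i N≤i → impossible⇒null λ ω eq → ℕₚ.<⇒≱ (f<N ω) (subst (N ℕ.≤_) (sym eq) N≤i)

    module _ (K : ℕ) (f≤1+K : ∀ ω → f ω ℕ.≤ suc K) where

      private
        E Σp top : ℕ → ℝ
        E n = Σ< n λ k → k ·ᵣ p k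
        Σp n = K ·ᵣ Σ< n p
        top n = Σp n +ᵣ p (suc K)

        null : ∀ {n} → suc K ℕ.< n → p n ≤ᵣ 0ᵣ
        null K<n = impossible⇒null λ ω eq →
          ℕₚ.<⇒≱ K<n (subst (ℕ._≤ suc K) eq (f≤1+K ω))

        extend : ∀ n x → Σp n +ᵣ (K ·ᵣ p n +ᵣ x) ≃ᵣ Σp (suc n) +ᵣ x
        extend n x = pointwise⇒≃ᵣ (Σp n +ᵣ (K ·ᵣ p n +ᵣ x)) (Σp (suc n) +ᵣ x) λ i →
          trans (sym (ℚₚ.+-assoc (seq (Σp n) i) (seq (K ·ᵣ p n) i) (seq x i)))
                (cong (ℚ._+ seq x i) (sym (·ᵣ-distribˡ-+ᵣ K (Σ< n p) (p n) i)))

        below : ∀ n → n ℕ.≤ suc K → E n ≤ᵣ Σp n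
        below zero    _         = ·ᵣ-nonneg K 0ᵣ (≤ᵣ-refl 0ᵣ)
        below (suc n) (s≤s n≤K) =
          ≤ᵣ-trans (E n +ᵣ n ·ᵣ p n) (Σp n +ᵣ K ·ᵣ p n) (Σp (suc n))
            (+ᵣ-mono-≤ (E n) (Σp n) (n ·ᵣ p n) (K ·ᵣ p n)
              (below n (ℕₚ.m≤n⇒m≤1+n n≤K)) (·ᵣ-monoˡ-≤ (p n) (p≥0 n) n≤K))
            (proj₂ (pointwise⇒≃ᵣ (Σp (suc n)) (Σp n +ᵣ K ·ᵣ p n)
              (·ᵣ-distribˡ-+ᵣ K (Σ< n p) (p n))))

        above : ∀ {n} → suc K ℕ.≤′ n → E (suc n) ≤ᵣ top (suc n)
        above ℕ.≤′-refl =
          ≤ᵣ-trans (E (suc K) +ᵣ suc K ·ᵣ p (suc K))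
                   (Σp (suc K) +ᵣ (K ·ᵣ p (suc K) +ᵣ p (suc K)))
                   (top (suc (suc K)))
            (+ᵣ-mono-≤ (E (suc K)) (Σp (suc K))
                       (suc K ·ᵣ p (suc K)) (K ·ᵣ p (suc K) +ᵣ p (suc K))
              (below (suc K) ℕₚ.≤-refl)
              (proj₁ (pointwise⇒≃ᵣ (suc K ·ᵣ p (suc K)) (K ·ᵣ p (suc K) +ᵣ p (suc K)) λ i →
                ℚₚ.+-comm (seq (p (suc K)) i) (seq (K ·ᵣ p (suc K)) i))))
            (proj₁ (extend (suc K) (p (suc K))))
        above (ℕ.≤′-step {n} K<n) =
          ≤ᵣ-trans (E (suc n) +ᵣ suc n ·ᵣ p (suc n)) (E (suc n)) (top (suc (suc n)))
            (x+nonpos≤x (E (suc n)) (suc n ·ᵣ p (suc n))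
              (·ᵣ-nonpos (suc n) (p (suc n)) (null (s≤s (ℕₚ.≤′⇒≤ K<n)))))
            (≤ᵣ-trans (E (suc n)) (top (suc n)) (top (suc (suc n))) (above K<n)
              (+ᵣ-mono-≤ (Σp (suc n)) (Σp (suc (suc n))) (p (suc K)) (p (suc K))
                (·ᵣ-monoʳ-≤ K (Σ< (suc n) p) (Σ< (suc (suc n)) p)
                  (Σ<-mono-≤ p p≥0 (ℕₚ.n≤1+n (suc n))))
                (≤ᵣ-refl (p (suc K)))))

      -- Values up to `K` count at most `K` each, the value `K + 1` counts one more, and the total
      -- mass is at most 1.
      𝔼-≤ : ∀ T → 𝔼 T f ≤ᵣ K ·ᵣ 1ᵣ +ᵣ p (suc K)
      𝔼-≤ T = ≤ᵣ-trans (E (suc T)) (top (suc T)) (K ·ᵣ 1ᵣ +ᵣ p (suc K)) E≤top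
        (+ᵣ-mono-≤ (Σp (suc T)) (K ·ᵣ 1ᵣ) (p (suc K)) (p (suc K))
          (·ᵣ-monoʳ-≤ K (Σ< (suc T) p) 1ᵣ (law-≤1 (suc T))) (≤ᵣ-refl (p (suc K))))
        where
        E≤top : E (suc T) ≤ᵣ top (suc T)
        E≤top with T ℕ.≤? K
        -- For `T ≤ K` the sum in `𝔼 T` stops before the value `K + 1`; adding the probability of
        -- that value only weakens the bound.
        ... | yes T≤K = ≤ᵣ-trans (E (suc T)) (Σp (suc T)) (top (suc T))
          (below (suc T) (s≤s T≤K)) (x≤x+nonneg (Σp (suc T)) (p (suc K)) (p≥0 (suc K)))
        ... | no  T≰K = above (ℕₚ.≤⇒≤′ (ℕₚ.≰⇒> T≰K))

  -- Otherwise each of the `N` values has probability at most `r + 2η`, and the total mass falls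
  -- below 1.
  some-value-likely : ∀ {f : Ω → ℕ} → Measurable f → ∀ N r η → 0ℚ ℚ.< η →
    (∀ ω → f ω ℕ.< N) → N ·ᵣ fromℚ (r ℚ.+ (η ℚ.+ η)) <ᵣ 1ᵣ →
    ∃ λ i → i ℕ.< N × fromℚ r ≤ᵣ ℙ (λ ω → f ω ≡ i)
  some-value-likely {f} f-measurable N r η η>0 f<N N·<1
    with large-summand (λ i → ℙ λ ω → f ω ≡ i) N r η η>0
  ... | inj₁ likely = likely
  ... | inj₂ Σ≤     = ⊥-elim (≤ᵣ⇒≯ᵣ 1ᵣ (N ·ᵣ s)
    (≤ᵣ-trans 1ᵣ (Σ< N λ i → ℙ λ ω → f ω ≡ i) (N ·ᵣ s) (law-≥1 f-measurable N f<N) Σ≤)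
    N·<1)
    where
    s : ℝ
    s = fromℚ (r ℚ.+ (η ℚ.+ η))

-- Fractional solutions in half units

sum-mono : ∀ {m} (x y : Vec ℕ m) → (∀ i → lookup x i ℕ.≤ lookup y i) → sum x ℕ.≤ sum y
sum-mono []      []      x≤y = z≤n
sum-mono (_ ∷ x) (_ ∷ y) x≤y = ℕₚ.+-mono-≤ (x≤y zero) (sum-mono x y (x≤y ∘ suc))

sum-replicate : ∀ m x → sum (replicate m x) ≡ m ℕ.* x
sum-replicate zero    x = refl
sum-replicate (suc m) x = cong (x ℕ.+_) (sum-replicate m x)

sum-updateAt-suc : ∀ {m} (x : Vec ℕ m) i → sum (updateAt x i suc) ≡ suc (sum x)
sum-updateAt-suc (x ∷ xs) zero    = refl
sum-updateAt-suc (x ∷ xs) (suc i) =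
  trans (cong (x ℕ.+_) (sum-updateAt-suc xs i)) (ℕₚ.+-suc x (sum xs))

sum-∸ : ∀ {m} (x y : Vec ℕ m) → sum x ℕ.≤ sum y ℕ.+ sum (zipWith ℕ._∸_ x y)
sum-∸ []       []       = z≤n
sum-∸ (x ∷ xs) (y ∷ ys) = ℕₚ.≤-trans
  (ℕₚ.+-mono-≤ (ℕₚ.m≤n+m∸n x y) (sum-∸ xs ys))
  (ℕₚ.≤-reflexive (ℕ+.interchange y (x ℕ.∸ y) (sum ys) _))
  where
  open import Algebra.Properties.CommutativeSemigroup ℕₚ.+-commutativeSemigroup as ℕ+ using ()

-- Work-conserving service in index order: by `sum-greedy≥` the whole budget `b` is spent as soon as
-- the total load reaches `b`.
greedy : ∀ {m} → ℕ → Vec ℕ m → Vec ℕ m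
greedy b []       = []
greedy b (x ∷ xs) = b ℕ.⊓ x ∷ greedy (b ℕ.∸ x) xs

greedy≤ : ∀ {m} b (x : Vec ℕ m) i → lookup (greedy b x) i ℕ.≤ lookup x i
greedy≤ b (x ∷ xs) zero    = ℕₚ.m⊓n≤n b x
greedy≤ b (x ∷ xs) (suc i) = greedy≤ (b ℕ.∸ x) xs i

sum-greedy≤ : ∀ {m} b (x : Vec ℕ m) → sum (greedy b x) ℕ.≤ b
sum-greedy≤ b []       = z≤n
sum-greedy≤ b (x ∷ xs) = ℕₚ.≤-trans
  (ℕₚ.+-monoʳ-≤ (b ℕ.⊓ x) (sum-greedy≤ (b ℕ.∸ x) xs))
  (ℕₚ.≤-reflexive (trans (cong (ℕ._+ (b ℕ.∸ x)) (ℕₚ.⊓-comm b x)) (ℕₚ.m⊓n+n∸m≡n x b)))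

sum-greedy≥ : ∀ {m} b (x : Vec ℕ m) → b ℕ.≤ sum x → b ℕ.≤ sum (greedy b x)
sum-greedy≥ b []       b≤ = b≤
sum-greedy≥ b (x ∷ xs) b≤ = ℕₚ.≤-trans
  (ℕₚ.≤-reflexive (trans (sym (ℕₚ.m⊓n+n∸m≡n x b)) (cong (ℕ._+ (b ℕ.∸ x)) (ℕₚ.⊓-comm x b))))
  (ℕₚ.+-monoʳ-≤ (b ℕ.⊓ x) (sum-greedy≥ (b ℕ.∸ x) xs (ℕₚ.m≤n+o⇒m∸n≤o b x b≤)))

unit : ∀ {m} → Fin m → Vec ℕ m
unit i = updateAt (replicate _ 0) i suc

pair : ∀ {m} → Fin m → Fin m → Vec ℕ m
pair i j = updateAt (unit i) j suc

sum-pair : ∀ {m} (i j : Fin m) → sum (pair i j) ≡ 2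
sum-pair {m} i j = trans (sum-updateAt-suc (unit i) j) (cong suc
  (trans (sum-updateAt-suc (replicate m 0) i) (cong suc
    (trans (sum-replicate m 0) (ℕₚ.*-zeroʳ m)))))

lookup-unit-≢ : ∀ {m} {i j : Fin m} → j ≢ i → lookup (unit i) j ≡ 0
lookup-unit-≢ {m} {i} {j} j≢i =
  trans (Vecₚ.lookup∘updateAt′ j i j≢i (replicate m 0)) (Vecₚ.lookup-replicate j 0)

lookup-unit-≡ : ∀ {m} (i : Fin m) → lookup (unit i) i ≡ 1
lookup-unit-≡ {m} i =
  trans (Vecₚ.lookup∘updateAt i (replicate m 0)) (cong suc (Vecₚ.lookup-replicate i 0))

unit≤1 : ∀ {m} (i l : Fin m) → lookup (unit i) l ℕ.≤ 1
unit≤1 i l with l Fin.≟ i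
... | yes refl = ℕₚ.≤-reflexive (lookup-unit-≡ i)
... | no  l≢i  = ℕₚ.≤-trans (ℕₚ.≤-reflexive (lookup-unit-≢ l≢i)) z≤n

pair≤1 : ∀ {m} (i j : Fin m) → j ≢ i → ∀ l → lookup (pair i j) l ℕ.≤ 1
pair≤1 i j j≢i l with l Fin.≟ j
... | yes refl = ℕₚ.≤-reflexive (trans (Vecₚ.lookup∘updateAt j (unit i)) (cong suc (lookup-unit-≢ j≢i)))
... | no  l≢j  = ℕₚ.≤-trans (ℕₚ.≤-reflexive (Vecₚ.lookup∘updateAt′ l j l≢j (unit i))) (unit≤1 i l)

halves : ℕ → ℚ
halves zero    = 0ℚ
halves (suc n) = ½ ℚ.+ halves n

halves-+ : ∀ j k → halves (j ℕ.+ k) ≡ halves j ℚ.+ halves k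
halves-+ zero    k = sym (ℚₚ.+-identityˡ (halves k))
halves-+ (suc j) k = trans (cong (½ ℚ.+_) (halves-+ j k)) (sym (ℚₚ.+-assoc ½ (halves j) (halves k)))

halves-nonneg : ∀ n → 0ℚ ℚ.≤ halves n
halves-nonneg zero    = ℚₚ.≤-refl
halves-nonneg (suc n) = ℚₚ.+-mono-≤ (ℚₚ.nonNegative⁻¹ ½) (halves-nonneg n)

halves-mono : ∀ {j k} → j ℕ.≤ k → halves j ℚ.≤ halves k
halves-mono {k = k} z≤n = halves-nonneg k
halves-mono (s≤s j≤k)   = ℚₚ.+-monoʳ-≤ ½ (halves-mono j≤k)

halves-⊓ : ∀ j k → halves (j ℕ.⊓ k) ≡ halves j ℚ.⊓ halves k
halves-⊓ j k with ℕₚ.≤-total j k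
... | inj₁ j≤k = trans (cong halves (ℕₚ.m≤n⇒m⊓n≡m j≤k)) (sym (ℚₚ.p≤q⇒p⊓q≡p (halves-mono j≤k)))
... | inj₂ k≤j = trans (cong halves (ℕₚ.m≥n⇒m⊓n≡n k≤j)) (sym (ℚₚ.p≥q⇒p⊓q≡q (halves-mono k≤j)))

halves-∸ : ∀ {j k} → k ℕ.≤ j → halves (j ℕ.∸ k) ≡ halves j ℚ.- halves k
halves-∸ {j} {k} k≤j = sym (begin
  halves j ℚ.- halves k
    ≡⟨ cong (λ l → halves l ℚ.- halves k) (ℕₚ.m∸n+n≡m k≤j) ⟨
  halves (j ℕ.∸ k ℕ.+ k) ℚ.- halves k
    ≡⟨ cong (ℚ._- halves k) (halves-+ (j ℕ.∸ k) k) ⟩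
  (halves (j ℕ.∸ k) ℚ.+ halves k) ℚ.- halves k
    ≡⟨ ℚₚ.+-assoc (halves (j ℕ.∸ k)) (halves k) _ ⟩
  halves (j ℕ.∸ k) ℚ.+ (halves k ℚ.- halves k)
    ≡⟨ cong (halves (j ℕ.∸ k) ℚ.+_) (ℚₚ.+-inverseʳ (halves k)) ⟩
  halves (j ℕ.∸ k) ℚ.+ 0ℚ
    ≡⟨ ℚₚ.+-identityʳ _ ⟩
  halves (j ℕ.∸ k) ∎)
  where open ≡-Reasoning

-- For a variable `n` the fraction `n / 1` is stuck on its gcd. Coprimality of `n` and 1 supplies
-- the reduced form, after which the addition unfolds.
suc/1 : ∀ n → ℤ.+ suc n ℚ./ 1 ≡ 1ℚ ℚ.+ ℤ.+ n ℚ./ 1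
suc/1 n rewrite ℚₚ.normalize-coprime {n} {0} (Coprimality.sym (Coprimality.1-coprimeTo n)) =
  cong (λ i → (ℤ.+ 1 ℤ.+ i) ℚ./ 1) (sym (ℤₚ.*-identityʳ (ℤ.+ n)))

halves-double : ∀ n → halves (n ℕ.+ n) ≡ ℤ.+ n ℚ./ 1
halves-double zero    = refl
halves-double (suc n) = begin
  ½ ℚ.+ halves (n ℕ.+ suc n)      ≡⟨ cong (λ k → ½ ℚ.+ halves k) (ℕₚ.+-suc n n) ⟩
  ½ ℚ.+ (½ ℚ.+ halves (n ℕ.+ n))  ≡⟨ ℚₚ.+-assoc ½ ½ (halves (n ℕ.+ n)) ⟨
  1ℚ ℚ.+ halves (n ℕ.+ n)         ≡⟨ cong (1ℚ ℚ.+_) (halves-double n) ⟩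
  1ℚ ℚ.+ ℤ.+ n ℚ./ 1              ≡⟨ suc/1 n ⟨
  ℤ.+ suc n ℚ./ 1                 ∎
  where open ≡-Reasoning

toAmounts : ∀ {m} → Vec ℕ m → Vec ℝ m
toAmounts = map (fromℚ ∘ halves)

seq-sumᵣ-toAmounts : ∀ {m} (u : Vec ℕ m) n → seq (sumᵣ (toAmounts u)) n ≡ halves (sum u)
seq-sumᵣ-toAmounts []      n = refl
seq-sumᵣ-toAmounts (h ∷ u) n =
  trans (cong (halves h ℚ.+_) (seq-sumᵣ-toAmounts u n)) (sym (halves-+ h (sum u)))

-- FRAC only sends multiples of ½, so its loads are counted in half units: the capacity is `B + B`
-- and a packet weighs 2. Loads and amounts sent are computed together, as the policy sees the
-- current load.
module HalfUnits {m} (B : ℕ) (σ : Input m) (policy : ℕ → Vec ℕ m → Vec ℕ m) where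

  halfInject : ℕ → ℕ → ℕ
  halfInject p x = (B ℕ.+ B) ℕ.⊓ (x ℕ.+ (p ℕ.+ p))

  halfLoad halfSent halfRest : ℕ → Vec ℕ m
  halfLoad zero    = zipWith halfInject (injected σ 0) (replicate m 0)
  halfLoad (suc t) = zipWith halfInject (injected σ (suc t)) (halfRest t)
  halfSent t = policy t (halfLoad t)
  halfRest t = zipWith ℕ._∸_ (halfLoad t) (halfSent t)

  halfLoad≤ : ∀ t i → lookup (halfLoad t) i ℕ.≤ B ℕ.+ B
  halfLoad≤ zero i =
    subst (ℕ._≤ _) (sym (Vecₚ.lookup-zipWith halfInject i (injected σ 0) (replicate m 0))) (ℕₚ.m⊓n≤m _ _)
  halfLoad≤ (suc t) i =
    subst (ℕ._≤ _) (sym (Vecₚ.lookup-zipWith halfInject i (injected σ (suc t)) (halfRest t))) (ℕₚ.m⊓n≤m _ _)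

  halfRest-lookup : ∀ t i →
    lookup (halfRest t) i ≡ lookup (halfLoad t) i ℕ.∸ lookup (halfSent t) i
  halfRest-lookup t i = Vecₚ.lookup-zipWith ℕ._∸_ i (halfLoad t) (halfSent t)

  halfRest≤ : ∀ t i → lookup (halfRest t) i ℕ.≤ B ℕ.+ B
  halfRest≤ t i = subst (ℕ._≤ _) (sym (halfRest-lookup t i))
    (ℕₚ.≤-trans (ℕₚ.m∸n≤m _ (lookup (halfSent t) i)) (halfLoad≤ t i))

  halfRest≤halfLoad : ∀ t i → lookup (halfRest t) i ℕ.≤ lookup (halfLoad (suc t)) i
  halfRest≤halfLoad t i =
    subst (lookup (halfRest t) i ℕ.≤_)
      (sym (Vecₚ.lookup-zipWith halfInject i (injected σ (suc t)) (halfRest t)))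
      (ℕₚ.⊓-glb (halfRest≤ t i) (ℕₚ.m≤m+n _ _))

  drain-step : ∀ t → sum (halfLoad t) ℕ.≤ sum (halfSent t) ℕ.+ sum (halfLoad (suc t))
  drain-step t = ℕₚ.≤-trans (sum-∸ (halfLoad t) (halfSent t))
    (ℕₚ.+-monoʳ-≤ (sum (halfSent t)) (sum-mono (halfRest t) (halfLoad (suc t)) (halfRest≤halfLoad t)))

  -- Buffer `k` is below capacity before the packet arrives, so at least half of the packet fits and
  -- the total grows by one half unit.
  gain-step : ∀ t k → injected σ (suc t) ≡ unit k → lookup (halfRest t) k ℕ.< B ℕ.+ B →
    suc (sum (halfLoad t)) ℕ.≤ sum (halfSent t) ℕ.+ sum (halfLoad (suc t))
  gain-step t k inj≡ rest<C = ℕₚ.≤-trans (s≤s (sum-∸ (halfLoad t) (halfSent t)))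
    (ℕₚ.≤-trans (ℕₚ.≤-reflexive (sym (ℕₚ.+-suc (sum (halfSent t)) (sum (halfRest t)))))
      (ℕₚ.+-monoʳ-≤ (sum (halfSent t))
        (ℕₚ.≤-trans (ℕₚ.≤-reflexive (sym (sum-updateAt-suc (halfRest t) k)))
          (sum-mono (updateAt (halfRest t) k suc) (halfLoad (suc t)) grows))))
    where
    grows : ∀ i → lookup (updateAt (halfRest t) k suc) i ℕ.≤ lookup (halfLoad (suc t)) i
    grows i with i Fin.≟ k
    ... | no  i≢k  = subst (ℕ._≤ _) (sym (Vecₚ.lookup∘updateAt′ i k i≢k (halfRest t)))
      (halfRest≤halfLoad t i)
    ... | yes refl = subst₂ ℕ._≤_
      (sym (Vecₚ.lookup∘updateAt i (halfRest t)))
      (sym (trans (Vecₚ.lookup-zipWith halfInject i (injected σ (suc t)) (halfRest t))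
        (cong (λ p → halfInject p (lookup (halfRest t) i))
          (trans (cong (λ v → lookup v i) inj≡) (lookup-unit-≡ i)))))
      -- A packet brings two half units, but room is known for one.
      (ℕₚ.⊓-glb rest<C (ℕₚ.≤-trans (ℕₚ.n≤1+n _) (ℕₚ.≤-reflexive (ℕₚ.+-comm 2 _))))

  drain : (∀ t → sum (halfSent t) ℕ.≤ 2) →
    ∀ s t → sum (halfLoad s) ℕ.≤ t ℕ.* 2 ℕ.+ sum (halfLoad (t ℕ.+ s))
  drain sent≤2 s zero    = ℕₚ.≤-refl
  drain sent≤2 s (suc t) = ℕₚ.≤-trans (drain sent≤2 s t)
    (ℕₚ.≤-trans (ℕₚ.+-monoʳ-≤ (t ℕ.* 2)
      (ℕₚ.≤-trans (drain-step (t ℕ.+ s)) (ℕₚ.+-monoˡ-≤ _ (sent≤2 (t ℕ.+ s)))))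
    (ℕₚ.≤-reflexive (trans (sym (ℕₚ.+-assoc (t ℕ.* 2) 2 _))
      (cong (ℕ._+ sum (halfLoad (suc t ℕ.+ s))) (ℕₚ.+-comm (t ℕ.* 2) 2)))))

  -- At most 2 half units leave per step and injections never lower a load, so `2r` half units keep
  -- a full packet available during each of the next `r` steps.
  drain-≥2 : (∀ t → sum (halfSent t) ℕ.≤ 2) →
    ∀ s r → r ℕ.* 2 ℕ.≤ sum (halfLoad s) → ∀ t → t ℕ.< r → 2 ℕ.≤ sum (halfLoad (t ℕ.+ s))
  drain-≥2 sent≤2 s r r*2≤ t t<r = ℕₚ.+-cancelˡ-≤ (t ℕ.* 2) 2 _
    (ℕₚ.≤-trans (ℕₚ.≤-reflexive (ℕₚ.+-comm (t ℕ.* 2) 2))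
      (ℕₚ.≤-trans (ℕₚ.*-monoˡ-≤ 2 t<r) (ℕₚ.≤-trans r*2≤ (drain sent≤2 s t))))

  module _ (sent≤load : ∀ t i → lookup (halfSent t) i ℕ.≤ lookup (halfLoad t) i) where

    private
      fracInject-halves : ∀ p x (r : ℝ) n → seq r n ≡ halves x →
        seq (fracInject B p r) n ≡ halves (halfInject p x)
      fracInject-halves p x r n eq = sym (begin
        halves ((B ℕ.+ B) ℕ.⊓ (x ℕ.+ (p ℕ.+ p)))
          ≡⟨ halves-⊓ (B ℕ.+ B) _ ⟩
        halves (B ℕ.+ B) ℚ.⊓ halves (x ℕ.+ (p ℕ.+ p))
          ≡⟨ cong₂ ℚ._⊓_ (halves-double B)
               (trans (halves-+ x _) (cong₂ ℚ._+_ (sym eq) (halves-double p))) ⟩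
        seq (fracInject B p r) n ∎)
        where open ≡-Reasoning

      lookup-toAmounts : ∀ u (i : Fin m) n → seq (lookup (toAmounts u) i) n ≡ halves (lookup u i)
      lookup-toAmounts u i n = cong (λ r → seq r n) (Vecₚ.lookup-map i (fromℚ ∘ halves) u)

    -- By induction over time. The bound `sent≤load` makes truncated subtraction of half units agree
    -- with subtraction of reals.
    fracLoad-halves : ∀ t i n →
      seq (lookup (fracLoad B σ (toAmounts ∘ halfSent) t) i) n ≡ halves (lookup (halfLoad t) i)
    fracLoad-halves zero i n = begin
      seq (lookup (fracLoad B σ (toAmounts ∘ halfSent) 0) i) n
        ≡⟨ cong (λ r → seq r n) (Vecₚ.lookup-zipWith (fracInject B) i (injected σ 0) (replicate m 0ᵣ)) ⟩
      seq (fracInject B (lookup (injected σ 0) i) (lookup (replicate m 0ᵣ) i)) n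
        ≡⟨ fracInject-halves (lookup (injected σ 0) i) (lookup (replicate m 0) i) (lookup (replicate m 0ᵣ) i) n
             (trans (cong (λ r → seq r n) (Vecₚ.lookup-replicate i 0ᵣ))
                    (cong halves (sym (Vecₚ.lookup-replicate i 0)))) ⟩
      halves (halfInject (lookup (injected σ 0) i) (lookup (replicate m 0) i))
        ≡⟨ cong halves (Vecₚ.lookup-zipWith halfInject i (injected σ 0) (replicate m 0)) ⟨
      halves (lookup (halfLoad 0) i) ∎
      where open ≡-Reasoning
    fracLoad-halves (suc t) i n = begin
      seq (lookup (fracLoad B σ s (suc t)) i) n
        ≡⟨ cong (λ r → seq r n) (Vecₚ.lookup-zipWith (fracInject B) i (injected σ (suc t)) rest) ⟩
      seq (fracInject B (lookup (injected σ (suc t)) i) (lookup rest i)) n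
        ≡⟨ fracInject-halves (lookup (injected σ (suc t)) i) (lookup (halfRest t) i) (lookup rest i) n rest≡ ⟩
      halves (halfInject (lookup (injected σ (suc t)) i) (lookup (halfRest t) i))
        ≡⟨ cong halves (Vecₚ.lookup-zipWith halfInject i (injected σ (suc t)) (halfRest t)) ⟨
      halves (lookup (halfLoad (suc t)) i) ∎
      where
      open ≡-Reasoning
      s : ℕ → Vec ℝ m
      s = toAmounts ∘ halfSent
      rest : Vec ℝ m
      rest = zipWith _-ᵣ_ (fracLoad B σ s t) (s t)
      rest≡ : seq (lookup rest i) n ≡ halves (lookup (halfRest t) i)
      rest≡ = begin
        seq (lookup rest i) n
          ≡⟨ cong (λ r → seq r n) (Vecₚ.lookup-zipWith _-ᵣ_ i (fracLoad B σ s t) (s t)) ⟩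
        seq (lookup (fracLoad B σ s t) i) n ℚ.- seq (lookup (s t) i) n
          ≡⟨ cong₂ ℚ._-_ (fracLoad-halves t i n) (lookup-toAmounts (halfSent t) i n) ⟩
        halves (lookup (halfLoad t) i) ℚ.- halves (lookup (halfSent t) i)
          ≡⟨ halves-∸ (sent≤load t i) ⟨
        halves (lookup (halfLoad t) i ℕ.∸ lookup (halfSent t) i)
          ≡⟨ cong halves (halfRest-lookup t i) ⟨
        halves (lookup (halfRest t) i) ∎

    module _ (sent≤2 : ∀ t → sum (halfSent t) ℕ.≤ 2) where

      halfUnitSolution : FractionalSolution B σ
      halfUnitSolution = record
        { sent        = toAmounts ∘ halfSent
        ; sent-nonneg = λ t i → pointwise⇒≤ᵣ 0ᵣ (lookup (toAmounts (halfSent t)) i) λ n →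
            subst (0ℚ ℚ.≤_) (sym (lookup-toAmounts (halfSent t) i n)) (halves-nonneg (lookup (halfSent t) i))
        ; sent≤load   = λ t i → pointwise⇒≤ᵣ
            (lookup (toAmounts (halfSent t)) i) (lookup (fracLoad B σ (toAmounts ∘ halfSent) t) i) λ n →
            subst₂ ℚ._≤_ (sym (lookup-toAmounts (halfSent t) i n)) (sym (fracLoad-halves t i n))
              (halves-mono (sent≤load t i))
        ; sent-total  = λ t → pointwise⇒≤ᵣ (sumᵣ (toAmounts (halfSent t))) 1ᵣ λ n →
            subst (ℚ._≤ 1ℚ) (sym (seq-sumᵣ-toAmounts (halfSent t) n)) (halves-mono (sent≤2 t))
        }

      throughput-full-speed : ∀ T → (∀ t → t ℕ.< T → 2 ℕ.≤ sum (halfSent t)) → ∀ n →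
        seq (FractionalSolution.throughput halfUnitSolution T) n ≡ seq (T ·ᵣ 1ᵣ) n
      throughput-full-speed zero    full n = refl
      throughput-full-speed (suc T) full n = trans
        (cong₂ ℚ._+_ (throughput-full-speed T (λ t t<T → full t (ℕₚ.m≤n⇒m≤1+n t<T)) n)
          (trans (seq-sumᵣ-toAmounts (halfSent T) n)
            (cong halves (ℕₚ.≤-antisym (sent≤2 T) (full T ℕₚ.≤-refl)))))
        (ℚₚ.+-comm (seq (T ·ᵣ 1ᵣ) n) 1ℚ)

-- Integral runs

sum-depart : ∀ {m} (d : Decision m) (x : Vec ℕ m) → departures d x ℕ.+ sum (depart d x) ≡ sum x
sum-depart nothing                x             = refl
sum-depart (just zero)            (zero ∷ x)    = refl
sum-depart (just zero)            (suc h ∷ x)   = cong (λ k → suc (k ℕ.+ (h ℕ.+ sum x))) (ℕₚ.⊓-zeroʳ h)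
sum-depart (just (suc i))         (h ∷ x)       = begin
  departures (just i) x ℕ.+ (h ℕ.+ sum (depart (just i) x))
    ≡⟨ ℕₚ.+-assoc (departures (just i) x) h _ ⟨
  (departures (just i) x ℕ.+ h) ℕ.+ sum (depart (just i) x)
    ≡⟨ cong (ℕ._+ sum (depart (just i) x)) (ℕₚ.+-comm _ h) ⟩
  (h ℕ.+ departures (just i) x) ℕ.+ sum (depart (just i) x)
    ≡⟨ ℕₚ.+-assoc h _ _ ⟩
  h ℕ.+ (departures (just i) x ℕ.+ sum (depart (just i) x))
    ≡⟨ cong (h ℕ.+_) (sum-depart (just i) x) ⟩
  h ℕ.+ sum x ∎
  where open ≡-Reasoning

departures≤1 : ∀ {m} (d : Decision m) (x : Vec ℕ m) → departures d x ℕ.≤ 1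
departures≤1 nothing  x = z≤n
departures≤1 (just i) x = ℕₚ.m⊓n≤n (lookup x i) 1

lookup-depart-≢ : ∀ {m} (d : Decision m) (x : Vec ℕ m) i → d ≢ just i →
  lookup (depart d x) i ≡ lookup x i
lookup-depart-≢ nothing  x i d≢i = refl
lookup-depart-≢ (just j) x i d≢i = Vecₚ.lookup∘updateAt′ i j (λ i≡j → d≢i (cong just (sym i≡j))) x

sum-bounded : ∀ {m} b (x : Vec ℕ m) → (∀ i → lookup x i ℕ.≤ b) → sum x ℕ.≤ m ℕ.* b
sum-bounded b []      x≤b = z≤n
sum-bounded b (_ ∷ x) x≤b = ℕₚ.+-mono-≤ (x≤b zero) (sum-bounded b x (x≤b ∘ suc))

module Integral {m} (B : ℕ) (σ : Input m) (d : ℕ → Decision m) where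

  rest : ℕ → Vec ℕ m
  rest t = depart (d t) (load B σ d t)

  load-lookup-suc : ∀ t i →
    lookup (load B σ d (suc t)) i ≡ inject B (lookup (injected σ (suc t)) i) (lookup (rest t) i)
  load-lookup-suc t i = Vecₚ.lookup-zipWith (inject B) i (injected σ (suc t)) (rest t)

  load≤ : ∀ t i → lookup (load B σ d t) i ℕ.≤ B
  load≤ zero    i = subst (ℕ._≤ B)
    (sym (Vecₚ.lookup-zipWith (inject B) i (injected σ 0) (replicate m 0))) (ℕₚ.m⊓n≤m B _)
  load≤ (suc t) i = subst (ℕ._≤ B) (sym (load-lookup-suc t i)) (ℕₚ.m⊓n≤m B _)

  sum-load≤ : ∀ t → sum (load B σ d t) ℕ.≤ m ℕ.* B
  sum-load≤ t = sum-bounded B (load B σ d t) (load≤ t)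

  packets≤ : ∀ T → packets B σ d T ℕ.≤ T
  packets≤ zero    = z≤n
  packets≤ (suc T) = ℕₚ.≤-trans (ℕₚ.+-mono-≤ (packets≤ T) (departures≤1 (d T) (load B σ d T)))
    (ℕₚ.≤-reflexive (ℕₚ.+-comm T 1))

  accepted : ℕ → ℕ
  accepted T = packets B σ d T ℕ.+ sum (load B σ d T)

  packets+rest : ∀ T → packets B σ d (suc T) ℕ.+ sum (rest T) ≡ accepted T
  packets+rest T = trans (ℕₚ.+-assoc (packets B σ d T) _ _)
    (cong (packets B σ d T ℕ.+_) (sum-depart (d T) (load B σ d T)))

  -- No packet injected at time `T + 1` is stored. This covers full buffers as well as times without
  -- any injection.
  Lost : ℕ → Set
  Lost T = ∀ i → lookup (injected σ (suc T)) i ≡ 0 ⊎ B ℕ.≤ lookup (rest T) i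

  accepted-step : ∀ T → Lost T → accepted (suc T) ℕ.≤ accepted T
  accepted-step T lost = ℕₚ.≤-trans
    (ℕₚ.+-monoʳ-≤ (packets B σ d (suc T)) (sum-mono (load B σ d (suc T)) (rest T) load≤rest))
    (ℕₚ.≤-reflexive (packets+rest T))
    where
    load≤rest : ∀ i → lookup (load B σ d (suc T)) i ℕ.≤ lookup (rest T) i
    load≤rest i = subst (ℕ._≤ lookup (rest T) i) (sym (load-lookup-suc T i)) (bound (lost i))
      where
      bound : lookup (injected σ (suc T)) i ≡ 0 ⊎ B ℕ.≤ lookup (rest T) i →
              inject B (lookup (injected σ (suc T)) i) (lookup (rest T) i) ℕ.≤ lookup (rest T) i
      bound (inj₁ p≡0) rewrite p≡0 = ℕₚ.≤-trans (ℕₚ.m⊓n≤n B _) (ℕₚ.≤-reflexive (ℕₚ.+-identityʳ _))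
      bound (inj₂ B≤)  = ℕₚ.≤-trans (ℕₚ.m⊓n≤m B _) B≤

  accepted-mono : ∀ {s t} → s ℕ.≤ t → (∀ u → s ℕ.≤ u → u ℕ.< t → Lost u) →
                  accepted t ℕ.≤ accepted s
  accepted-mono {s} s≤t lost = go (ℕₚ.≤⇒≤′ s≤t) lost
    where
    go : ∀ {t} → s ℕ.≤′ t → (∀ u → s ℕ.≤ u → u ℕ.< t → Lost u) → accepted t ℕ.≤ accepted s
    go ℕ.≤′-refl            lost = ℕₚ.≤-refl
    go (ℕ.≤′-step {t} s≤′t) lost = ℕₚ.≤-trans
      (accepted-step t (lost t (ℕₚ.≤′⇒≤ s≤′t) ℕₚ.≤-refl))
      (go s≤′t λ u s≤u u<t → lost u s≤u (ℕₚ.m≤n⇒m≤1+n u<t))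

quiet⇒lost : ∀ {m} B (σ : Input m) d T → injected σ (suc T) ≡ replicate m 0 → Integral.Lost B σ d T
quiet⇒lost B σ d T quiet i = inj₁ (trans (cong (λ v → lookup v i) quiet) (Vecₚ.lookup-replicate i 0))

-- Measurability of the packet count of a random run

module _ (m : ℕ) where

  _≟ᵈ_ : (c d : Decision m) → Dec (c ≡ d)
  _≟ᵈ_ = Maybeₚ.≡-dec Fin._≟_

  enumDecision : ℕ → Decision m
  enumDecision n with n ℕ.<? m
  ... | yes n<m = just (Fin.fromℕ< n<m)
  ... | no  _   = nothing

  enumDecision-onto : ∀ d → ∃ λ n → enumDecision n ≡ d
  enumDecision-onto (just i) = toℕ i , eq
    where
    eq : enumDecision (toℕ i) ≡ just i
    eq with toℕ i ℕ.<? m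
    ... | yes i<m = cong just (Finₚ.fromℕ<-toℕ i i<m)
    ... | no  i≮m = ⊥-elim (i≮m (Finₚ.toℕ<n i))
  enumDecision-onto nothing = m , eq
    where
    eq : enumDecision m ≡ nothing
    eq with m ℕ.<? m
    ... | yes m<m = ⊥-elim (ℕₚ.n≮n m m<m)
    ... | no  _   = refl

module RandomRun (S : ProbabilitySpace) {m : ℕ} where
  open ProbabilitySpace S
  open Probability S

  decision-, : ∀ {A : Set} {D : Ω → Decision m} {Y : Ω → A} →
    (∀ d → Event (λ ω → D ω ≡ d)) → Measurable Y → Measurable (λ ω → D ω , Y ω)
  decision-, = measurable-, (_≟ᵈ_ m) (enumDecision m) (enumDecision-onto m)

  -- The packet count alone obeys no recursion, but the pair of count and loads does: its next value
  -- is a function of the current pair and one decision.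
  packets-measurable : ∀ B (σ : Input m) (D : Ω → ℕ → Decision m) →
    (∀ t d → Event (λ ω → D ω t ≡ d)) → ∀ T → Measurable (λ ω → packets B σ (D ω) T)
  packets-measurable B σ D D-event T Q? = state-measurable T (λ (p , x) → Q? p)
    where
    state : Ω → ℕ → ℕ × Vec ℕ m
    state ω T = packets B σ (D ω) T , load B σ (D ω) T

    state-measurable : ∀ T → Measurable (λ ω → state ω T)
    state-measurable zero    = measurable-const _
    state-measurable (suc T) Q? = decision-, (D-event T) (state-measurable T)
      λ (d , p , x) → Q? (p ℕ.+ departures d x , zipWith (inject B) (injected σ (suc T)) (depart d x))

-- The adversary

injected-gap : ∀ {m} n (q : Vec ℕ m) {t} → t ≢ n →
  injected (List.replicate n (replicate m 0) ++ q ∷ []) t ≡ replicate m 0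
injected-gap zero    q {zero}  t≢n = ⊥-elim (t≢n refl)
injected-gap zero    q {suc t} t≢n = refl
injected-gap (suc n) q {zero}  t≢n = refl
injected-gap (suc n) q {suc t} t≢n = injected-gap n q (t≢n ∘ cong suc)

injected-after-gap : ∀ {m} n (q : Vec ℕ m) →
  injected (List.replicate n (replicate m 0) ++ q ∷ []) n ≡ q
injected-after-gap zero    q = refl
injected-after-gap (suc n) q = injected-after-gap n q

among₂ : ∀ {m′} → Fin 2 → Fin (3 ℕ.+ m′)
among₂ {m′} a = a ↑ˡ suc m′

among₃ : ∀ {m′} → Fin 3 → Fin (3 ℕ.+ m′)
among₃ {m′} k = k ↑ˡ m′

-- Here `2 + n` is the total capacity N. Writing it so lets the first two steps be split off by
-- computation.
module Adversary (m′ b n : ℕ) (size : (3 ℕ.+ m′) ℕ.* suc b ≡ 2 ℕ.+ n) where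

  m B : ℕ
  m = 3 ℕ.+ m′
  B = suc b

  full : Vec ℕ m
  full = replicate m B

  -- The last `full` arrives at time `3 + n`, that is N + 1: FRAC needs the N - 1 steps from time 2
  -- on to drain its N - 1 packets.
  input : Fin 2 → Fin 3 → Input m
  input a k = full ∷ unit (among₂ a) ∷ unit (among₃ k) ∷ List.replicate n (replicate m 0) ++ full ∷ []

  -- The first two amounts are fixed vectors independent of the load and of `k`, the first one also
  -- of `a`. The early histories therefore reveal nothing about later injections.
  policy : Fin 2 → ℕ → Vec ℕ m → Vec ℕ m
  policy a 0             _ = pair zero (suc zero)
  policy a 1             _ = pair (among₂ a) (suc (suc zero))
  policy a (suc (suc t)) x = greedy 2 x

  first-sent : ∀ a → 1 ℕ.≤ lookup (pair {m} zero (suc zero)) (among₂ a)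
  first-sent zero       = s≤s z≤n
  first-sent (suc zero) = s≤s z≤n

  -- After two steps each of the first three buffers is below capacity, so
  -- half of the second single packet fits, whatever k is.
  second-sent : ∀ a k →
    1 ℕ.≤ lookup (pair {m} (among₂ a) (suc (suc zero))) (among₃ k) ⊎
    (1 ℕ.≤ lookup (pair {m} zero (suc zero)) (among₃ k) × lookup (unit {m} (among₂ a)) (among₃ k) ≡ 0)
  second-sent zero       zero             = inj₁ (s≤s z≤n)
  second-sent zero       (suc zero)       = inj₂ (s≤s z≤n , refl)
  second-sent zero       (suc (suc zero)) = inj₁ (s≤s z≤n)
  second-sent (suc zero) zero             = inj₂ (s≤s z≤n , refl)
  second-sent (suc zero) (suc zero)       = inj₁ (s≤s z≤n)
  second-sent (suc zero) (suc (suc zero)) = inj₁ (s≤s z≤n)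

  module Fractional (a : Fin 2) (k : Fin 3) where
    open HalfUnits B (input a k) (policy a) public

    initially-full : ∀ i → lookup (halfLoad 0) i ≡ B ℕ.+ B
    initially-full i = trans (Vecₚ.lookup-zipWith halfInject i full (replicate m 0))
      (trans (cong₂ halfInject (Vecₚ.lookup-replicate i B) (Vecₚ.lookup-replicate i 0))
        (ℕₚ.⊓-idem (B ℕ.+ B)))

    early-pair≤1 : ∀ l → lookup (halfSent 1) l ℕ.≤ 1
    early-pair≤1 = pair≤1 (among₂ a) (suc (suc zero)) (third≢ a)
      where
      third≢ : ∀ a → suc (suc zero) ≢ among₂ {m′} a
      third≢ zero       ()
      third≢ (suc zero) ()

    sent≤load : ∀ t i → lookup (halfSent t) i ℕ.≤ lookup (halfLoad t) i
    sent≤load 0 i = ℕₚ.≤-trans (pair≤1 zero (suc zero) (λ ()) i)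
      (ℕₚ.≤-trans (s≤s z≤n) (ℕₚ.≤-reflexive (sym (initially-full i))))
    -- After step 0 every buffer still holds at least `2B - 1` half units, and this is at least 1.
    sent≤load 1 i = ℕₚ.≤-trans (early-pair≤1 i) (ℕₚ.≤-trans
      (subst (1 ℕ.≤_) (sym (halfRest-lookup 0 i))
        (ℕₚ.≤-trans (ℕₚ.m≤n+m 1 b)
          (ℕₚ.≤-trans (ℕₚ.+-monoʳ-≤ b (s≤s (z≤n {b})))
            (ℕₚ.∸-mono (ℕₚ.≤-reflexive (sym (initially-full i))) (pair≤1 zero (suc zero) (λ ()) i)))))
      (halfRest≤halfLoad 0 i))
    sent≤load (suc (suc t)) i = greedy≤ 2 (halfLoad (suc (suc t))) i

    sent≤2 : ∀ t → sum (halfSent t) ℕ.≤ 2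
    sent≤2 0             = ℕₚ.≤-reflexive (sum-pair {m} zero (suc zero))
    sent≤2 1             = ℕₚ.≤-reflexive (sum-pair (among₂ a) (suc (suc zero)))
    sent≤2 (suc (suc t)) = sum-greedy≤ 2 (halfLoad (suc (suc t)))

    solution : FractionalSolution B (input a k)
    solution = halfUnitSolution sent≤load sent≤2

    rest<capacity : ∀ t i → 1 ℕ.≤ lookup (halfSent t) i → lookup (halfRest t) i ℕ.< B ℕ.+ B
    rest<capacity t i 1≤ = subst (ℕ._< B ℕ.+ B) (sym (halfRest-lookup t i))
      (s≤s (ℕₚ.∸-mono (halfLoad≤ t i) 1≤))

    -- Used when buffer `k` has made room in step 0 and receives nothing at time 1: the room is
    -- still there after step 1.
    still-below : ∀ i → 1 ℕ.≤ lookup (halfSent 0) i → lookup (unit (among₂ a)) i ≡ 0 →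
                  lookup (halfRest 1) i ℕ.< B ℕ.+ B
    still-below i 1≤ inj≡0 = ℕₚ.≤-trans (s≤s (ℕₚ.≤-trans
      (ℕₚ.≤-trans (ℕₚ.≤-reflexive (halfRest-lookup 1 i)) (ℕₚ.m∸n≤m _ (lookup (halfSent 1) i)))
      (ℕₚ.≤-trans
        (ℕₚ.≤-reflexive (Vecₚ.lookup-zipWith halfInject i (unit (among₂ a)) (halfRest 0)))
        (ℕₚ.≤-trans (ℕₚ.m⊓n≤n (B ℕ.+ B) _)
          (ℕₚ.≤-reflexive (trans (cong (λ p → lookup (halfRest 0) i ℕ.+ (p ℕ.+ p)) inj≡0)
            (ℕₚ.+-identityʳ _)))))))
      (rest<capacity 0 i 1≤)

    second-gap : lookup (halfRest 1) (among₃ k) ℕ.< B ℕ.+ B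
    second-gap with second-sent a k
    ... | inj₁ 1≤           = rest<capacity 1 (among₃ k) 1≤
    ... | inj₂ (1≤ , inj≡0) = still-below (among₃ k) 1≤ inj≡0

    full⇒sum≥ : ∀ (x : Vec ℕ m) → (∀ i → B ℕ.+ B ℕ.≤ lookup x i) → (2 ℕ.+ n) ℕ.* 2 ℕ.≤ sum x
    full⇒sum≥ x x≥ = ℕₚ.≤-trans (ℕₚ.≤-reflexive (begin
      (2 ℕ.+ n) ℕ.* 2               ≡⟨ cong (ℕ._* 2) size ⟨
      m ℕ.* B ℕ.* 2                 ≡⟨ ℕₚ.*-assoc m B 2 ⟩
      m ℕ.* (B ℕ.* 2)               ≡⟨ cong (m ℕ.*_) (ℕₚ.*-comm B 2) ⟩
      m ℕ.* (B ℕ.+ (B ℕ.+ 0))       ≡⟨ cong (λ c → m ℕ.* (B ℕ.+ c)) (ℕₚ.+-identityʳ B) ⟩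
      m ℕ.* (B ℕ.+ B)               ≡⟨ sum-replicate m (B ℕ.+ B) ⟨
      sum (replicate m (B ℕ.+ B))   ∎))
      (sum-mono (replicate m (B ℕ.+ B)) x λ i →
        subst (ℕ._≤ lookup x i) (sym (Vecₚ.lookup-replicate i (B ℕ.+ B))) (x≥ i))
      where open ≡-Reasoning

    -- Initially 2N half units; four are sent in steps 0 and 1, and one is regained from each single
    -- packet, which leaves 2N - 2.
    sum-load-2 : (1 ℕ.+ n) ℕ.* 2 ℕ.≤ sum (halfLoad 2)
    sum-load-2 = ℕₚ.+-cancelˡ-≤ 2 _ _ (ℕₚ.+-cancelˡ-≤ 2 _ _
      (ℕₚ.≤-trans (s≤s (s≤s (full⇒sum≥ (halfLoad 0) λ i → ℕₚ.≤-reflexive (sym (initially-full i)))))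
      (ℕₚ.≤-trans (s≤s (ℕₚ.≤-trans (gain-step 0 (among₂ a) refl (rest<capacity 0 (among₂ a) (first-sent a)))
          (ℕₚ.+-monoˡ-≤ _ (sent≤2 0))))
      (s≤s (s≤s (ℕₚ.≤-trans (gain-step 1 (among₃ k) refl second-gap) (ℕₚ.+-monoˡ-≤ _ (sent≤2 1))))))))

    sum-load-flood : (2 ℕ.+ n) ℕ.* 2 ℕ.≤ sum (halfLoad (3 ℕ.+ n))
    sum-load-flood = full⇒sum≥ (halfLoad (3 ℕ.+ n)) λ i → subst (B ℕ.+ B ℕ.≤_)
      (sym (trans
        (Vecₚ.lookup-zipWith halfInject i (injected (input a k) (3 ℕ.+ n)) (halfRest (2 ℕ.+ n)))
        (cong (λ p → halfInject p (lookup (halfRest (2 ℕ.+ n)) i))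
          (trans (cong (λ v → lookup v i) (injected-after-gap n full)) (Vecₚ.lookup-replicate i B)))))
      (ℕₚ.⊓-glb ℕₚ.≤-refl (ℕₚ.m≤n+m (B ℕ.+ B) _))

    full-speed : ∀ t → t ℕ.< suc ((2 ℕ.+ n) ℕ.+ (2 ℕ.+ n)) → 2 ℕ.≤ sum (halfSent t)
    full-speed 0             _ = ℕₚ.≤-reflexive (sym (sum-pair {m} zero (suc zero)))
    full-speed 1             _ = ℕₚ.≤-reflexive (sym (sum-pair (among₂ a) (suc (suc zero))))
    full-speed (suc (suc s)) (s≤s (s≤s s<)) = sum-greedy≥ 2 (halfLoad (2 ℕ.+ s)) load≥2
      where
      load≥2 : 2 ℕ.≤ sum (halfLoad (2 ℕ.+ s))
      -- Time `2 + s` precedes the final refill exactly when `s < 1 + n`. Before it the load at time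
      -- 2 suffices; from then on `r` counts the steps since the refill.
      load≥2 with s ℕ.<? 1 ℕ.+ n
      ... | yes s<1+n = subst (λ t → 2 ℕ.≤ sum (halfLoad t)) (ℕₚ.+-comm s 2)
        (drain-≥2 sent≤2 2 (1 ℕ.+ n) sum-load-2 s s<1+n)
      ... | no  s≮1+n = subst (λ t → 2 ℕ.≤ sum (halfLoad t)) time
        (drain-≥2 sent≤2 (3 ℕ.+ n) (2 ℕ.+ n) sum-load-flood r
          (ℕₚ.+-cancelʳ-< (1 ℕ.+ n) r (2 ℕ.+ n)
            (subst₂ ℕ._<_ (sym r+1+n≡s) (ℕₚ.+-comm (1 ℕ.+ n) (2 ℕ.+ n)) s<)))
        where
        r : ℕ
        r = s ℕ.∸ (1 ℕ.+ n)
        r+1+n≡s : r ℕ.+ (1 ℕ.+ n) ≡ s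
        r+1+n≡s = ℕₚ.m∸n+n≡m (ℕₚ.≮⇒≥ s≮1+n)
        time : r ℕ.+ (3 ℕ.+ n) ≡ 2 ℕ.+ s
        time = trans (ℕₚ.+-suc r (2 ℕ.+ n)) (cong suc (trans (ℕₚ.+-suc r (1 ℕ.+ n)) (cong suc r+1+n≡s)))

  module Rounded (a : Fin 2) (k : Fin 3) (d : ℕ → Decision m) where
    σ : Input m
    σ = input a k
    open Integral B σ d

    quiet : ∀ u → 2 ℕ.≤ u → u ≢ 2 ℕ.+ n → Lost u
    quiet (suc (suc u)) (s≤s (s≤s _)) u≢ =
      quiet⇒lost B σ d (2 ℕ.+ u) (injected-gap n full λ u≡n → u≢ (cong (2 ℕ.+_) u≡n))

    packets-total : ∀ L → 2 ℕ.+ n ℕ.≤ L → packets B σ d (3 ℕ.+ n) ℕ.≤ L →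
                    ∀ T → packets B σ d T ℕ.≤ L ℕ.+ (2 ℕ.+ n)
    packets-total L N≤L ≤L T with T ℕ.≤? 2 ℕ.+ n
    ... | yes T≤N = ℕₚ.≤-trans (packets≤ T) (ℕₚ.≤-trans T≤N (ℕₚ.m≤n+m _ L))
    ... | no  T≰N = ℕₚ.≤-trans (ℕₚ.m≤m+n _ _) (ℕₚ.≤-trans
      (accepted-mono (ℕₚ.≰⇒> T≰N) λ u flood≤u _ →
        quiet u (ℕₚ.≤-trans (s≤s (s≤s z≤n)) flood≤u) λ u≡ → ℕₚ.<-irrefl (sym u≡) flood≤u)
      (ℕₚ.+-mono-≤ ≤L (subst (sum (load B σ d (3 ℕ.+ n)) ℕ.≤_) size (sum-load≤ (3 ℕ.+ n)))))

    -- One packet per step gives at most N + 1 before the final refill.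
    packets-≤ : ∀ T → packets B σ d T ℕ.≤ suc ((2 ℕ.+ n) ℕ.+ (2 ℕ.+ n))
    packets-≤ = packets-total (3 ℕ.+ n) (ℕₚ.n≤1+n _) (packets≤ (3 ℕ.+ n))

    module _ (d₀≢a : d 0 ≢ just (among₂ a))
             (d₀≢k : d 0 ≢ just (among₃ k)) (d₁≢k : d 1 ≢ just (among₃ k)) where

      full-at-0 : ∀ i → lookup (load B σ d 0) i ≡ B
      full-at-0 i = trans (Vecₚ.lookup-zipWith (inject B) i full (replicate m 0))
        (trans (cong₂ (inject B) (Vecₚ.lookup-replicate i B) (Vecₚ.lookup-replicate i 0))
          (ℕₚ.⊓-idem B))

      untouched-at-0 : ∀ i → d 0 ≢ just i → B ℕ.≤ lookup (rest 0) i
      untouched-at-0 i d₀≢i = ℕₚ.≤-reflexive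
        (sym (trans (lookup-depart-≢ (d 0) (load B σ d 0) i d₀≢i) (full-at-0 i)))

      unit-lost : ∀ T i → injected σ (suc T) ≡ unit i → B ℕ.≤ lookup (rest T) i → Lost T
      unit-lost T i inj≡ B≤ l with l Fin.≟ i
      ... | yes refl = inj₂ B≤
      ... | no  l≢i  = inj₁ (trans (cong (λ v → lookup v l) inj≡) (lookup-unit-≢ l≢i))

      lost : ∀ u → u ℕ.< 2 ℕ.+ n → Lost u
      lost 0 _ = unit-lost 0 (among₂ a) refl (untouched-at-0 (among₂ a) d₀≢a)
      -- Buffer `k` is served in neither step, so it is still full when the second single packet
      -- arrives.
      lost 1 _ = unit-lost 1 (among₃ k) refl (subst (B ℕ.≤_)
        (sym (trans (lookup-depart-≢ (d 1) (load B σ d 1) (among₃ k) d₁≢k) (load-lookup-suc 0 (among₃ k))))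
        (ℕₚ.⊓-glb ℕₚ.≤-refl (ℕₚ.≤-trans (untouched-at-0 (among₃ k) d₀≢k) (ℕₚ.m≤m+n _ _))))
      lost (suc (suc u)) u< = quiet (suc (suc u)) (s≤s (s≤s z≤n)) (ℕₚ.<⇒≢ u<)

      -- With both single packets lost, everything sent before the final refill stems from the N
      -- packets injected at time 0.
      packets-< : ∀ T → packets B σ d T ℕ.≤ (2 ℕ.+ n) ℕ.+ (2 ℕ.+ n)
      packets-< = packets-total (2 ℕ.+ n) ℕₚ.≤-refl
        (ℕₚ.≤-trans (ℕₚ.m≤m+n _ _) (ℕₚ.≤-trans (ℕₚ.≤-reflexive (packets+rest (2 ℕ.+ n)))
          (ℕₚ.≤-trans (accepted-mono z≤n λ u _ → lost u)
            (subst (sum (load B σ d 0) ℕ.≤_) size (sum-load≤ 0)))))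

-- Injections missed by a given pair of decisions

module _ (m′ : ℕ) where

  private
    D : Set
    D = Decision (3 ℕ.+ m′)

  avoid₁ : (c : D) → ∃ λ a → c ≢ just (among₂ a)
  avoid₁ nothing              = zero , λ ()
  avoid₁ (just zero)          = suc zero , λ ()
  avoid₁ (just (suc i))       = zero , λ ()

  private
    two-free : (c : D) → ∃₂ λ j k → j ≢ k × c ≢ just (among₃ j) × c ≢ just (among₃ k)
    two-free nothing                    = zero , suc zero , (λ ()) , (λ ()) , λ ()
    two-free (just zero)                = suc zero , suc (suc zero) , (λ ()) , (λ ()) , λ ()
    two-free (just (suc zero))          = zero , suc (suc zero) , (λ ()) , (λ ()) , λ ()
    two-free (just (suc (suc i)))       = zero , suc zero , (λ ()) , (λ ()) , λ ()

  -- Decision `c` leaves two of the three buffers free, and `d` can block only one of these.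
  avoid₂ : (c d : D) → ∃ λ k → c ≢ just (among₃ k) × d ≢ just (among₃ k)
  avoid₂ c d with two-free c
  ... | j , k , j≢k , c≢j , c≢k with _≟ᵈ_ _ d (just (among₃ j))
  ... | no  d≢j  = j , c≢j , d≢j
  ... | yes refl = k , c≢k , λ eq → j≢k (Finₚ.↑ˡ-injective m′ j k (Maybeₚ.just-injective eq))

  -- e a is the second decision if the first single packet arrives at buffer a
  choose : D → (Fin 2 → D) → Fin 2 × Fin 3
  choose c e = proj₁ (avoid₁ c) , proj₁ (avoid₂ c (e (proj₁ (avoid₁ c))))

  choose-spec : ∀ c e {a k} → choose c e ≡ (a , k) →
    c ≢ just (among₂ a) × c ≢ just (among₃ k) × e a ≢ just (among₃ k)
  choose-spec c e refl = proj₂ (avoid₁ c) , proj₂ (avoid₂ c (e (proj₁ (avoid₁ c))))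

-- Tabulates the second decisions for both values of `a`. The bad pair thus depends on three
-- decisions, which keeps it measurable.
select : ∀ {A : Set} → A → A → Fin 2 → A
select x y zero       = x
select x y (suc zero) = y

select-η : ∀ {A : Set} (e : Fin 2 → A) a → select (e zero) (e (suc zero)) a ≡ e a
select-η e zero       = refl
select-η e (suc zero) = refl

⅛ : ℚ
⅛ = ℤ.+ 1 ℚ./ 8

η : ℚ
η = ℤ.+ 1 ℚ./ 64

-- The left side is 6 (1/8 + 2/64) = 15/16, so 1/16 is the exact gap.
six-small : 6 ·ᵣ fromℚ (⅛ ℚ.+ (η ℚ.+ η)) <ᵣ 1ᵣ
six-small = ⅛/2 , from-yes (0ℚ ℚ.<? ⅛/2) , 0 , λ _ _ →
  from-yes (seq (6 ·ᵣ fromℚ (⅛ ℚ.+ (η ℚ.+ η))) 0 ℚ.+ ⅛/2 ℚ.≤? 1ℚ)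
  where
  ⅛/2 : ℚ
  ⅛/2 = ℤ.+ 1 ℚ./ 16

-- Expected throughput against the adversary

module Beating (m′ b n : ℕ) (size : (3 ℕ.+ m′) ℕ.* suc b ≡ 2 ℕ.+ n)
             (RAND : RoundingAlgorithm (3 ℕ.+ m′)) where
  open Adversary m′ b n size
  open RoundingAlgorithm RAND
  open ProbabilitySpace space
  open Probability space
  open RandomRun space {m}

  solution : ∀ a k → FractionalSolution B (input a k)
  solution = Fractional.solution

  -- The history known to the first decision involves neither a nor k, the one
  -- known to the second decision does not involve k.
  first : Ω → Decision m
  first ω = decide ω ((full , toAmounts (pair zero (suc zero))) ∷ [])

  second : Fin 2 → Ω → Decision m
  second a ω = decide ω
    ((full , toAmounts (pair zero (suc zero))) ∷
     (unit (among₂ a) , toAmounts (pair (among₂ a) (suc (suc zero)))) ∷ [])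

  scenario : Ω → Fin 2 × Fin 3
  scenario ω = choose m′ (first ω) (select (second zero ω) (second (suc zero) ω))

  -- Numbers the six choices of `(a , k)`, since `some-value-likely` speaks of random natural
  -- numbers.
  code : Ω → ℕ
  code ω = toℕ (Fin.combine (proj₁ (scenario ω)) (proj₂ (scenario ω)))

  code-measurable : Measurable code
  code-measurable Q? =
    -- The nested pairs collect the first decision and the second decisions for both values of `a`,
    -- starting from a constant.
    decision-, (decide-event _) (decision-, (decide-event _) (decision-, (decide-event _) (measurable-const 0)))
      λ (c , x , y , _) → let a , k = choose m′ c (select x y) in Q? (toℕ (Fin.combine a k))

  K : ℕ
  K = (2 ℕ.+ n) ℕ.+ (2 ℕ.+ n)

  module _ (a : Fin 2) (k : Fin 3) where

    X : ℕ → Ω → ℕ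
    X T ω = packets B (input a k) (run (input a k) (solution a k) ω) T

    X-measurable : ∀ T → Measurable (X T)
    X-measurable = packets-measurable B (input a k) (run (input a k) (solution a k)) λ t → decide-event _

    X≤ : ∀ T ω → X T ω ℕ.≤ suc K
    X≤ T ω = Rounded.packets-≤ a k (run (input a k) (solution a k) ω) T

    X< : ∀ T ω → scenario ω ≡ (a , k) → X T ω ℕ.≤ K
    X< T ω eq with choose-spec m′ (first ω) (select (second zero ω) (second (suc zero) ω)) eq
    -- On `input a k` the run reduces to `first ω` in step 0 and to `second a ω` in step 1, so the
    -- properties of `choose` apply to it.
    ... | c≢a , c≢k , e≢k = Rounded.packets-< a k (run (input a k) (solution a k) ω) c≢a c≢k
      (subst (_≢ just (among₃ k)) (select-η (λ a → second a ω) a) e≢k) T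

    throughput-suc-K : ∀ i → seq (FractionalSolution.throughput (solution a k) (suc K)) i ≡ seq (suc K ·ᵣ 1ᵣ) i
    throughput-suc-K = Fractional.throughput-full-speed a k
      (Fractional.sent≤load a k) (Fractional.sent≤2 a k) (suc K) (Fractional.full-speed a k)

    module _ (i : ℕ) (code≡⇒ : ∀ ω → code ω ≡ i → scenario ω ≡ (a , k))
             (likely : fromℚ ⅛ ≤ᵣ ℙ (λ ω → code ω ≡ i)) where

      bound : ℝ
      bound = K ·ᵣ 1ᵣ +ᵣ fromℚ (1ℚ ℚ.- ⅛)

      -- The maximum K + 1 is never attained on the bad scenario, so the two events are disjoint and
      -- the latter takes at least 1/8 of the mass.
      ℙ-max≤ : ∀ T → ℙ (λ ω → X T ω ≡ suc K) ≤ᵣ fromℚ (1ℚ ℚ.- ⅛)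
      ℙ-max≤ T = ≤ᵣ-minus P Q ⅛ 1ℚ likely
        (disjoint-+≤1 (λ ω → X T ω ℕ.≟ suc K) (λ ω → code ω ℕ.≟ i)
          (X-measurable T (ℕ._≟ suc K)) (code-measurable (ℕ._≟ i))
          λ {ω} (x≡ , c≡) → ℕₚ.<-irrefl x≡ (s≤s (X< T ω (code≡⇒ ω c≡))))
        where
        P Q : ℝ
        P = ℙ (λ ω → X T ω ≡ suc K)
        Q = ℙ (λ ω → code ω ≡ i)

      expected≤ : ∀ T → expectedThroughput (input a k) (solution a k) T ≤ᵣ bound
      expected≤ T = ≤ᵣ-trans (𝔼 T (X T)) (K ·ᵣ 1ᵣ +ᵣ ℙ (λ ω → X T ω ≡ suc K)) bound
        (𝔼-≤ (X-measurable T) K (X≤ T) T)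
        (+ᵣ-mono-≤ (K ·ᵣ 1ᵣ) (K ·ᵣ 1ᵣ) (ℙ (λ ω → X T ω ≡ suc K)) (fromℚ (1ℚ ℚ.- ⅛))
          (≤ᵣ-refl (K ·ᵣ 1ᵣ)) (ℙ-max≤ T))

      bound< : bound <ᵣ FractionalSolution.throughput (solution a k) (suc K)
      -- FRAC has sent exactly K + 1 after K + 1 steps, which exceeds K + 7/8 by 1/8.
      bound< = ⅛ , from-yes (0ℚ ℚ.<? ⅛) , 0 , λ j _ → ℚₚ.≤-reflexive (begin
        (seq (K ·ᵣ 1ᵣ) j ℚ.+ (1ℚ ℚ.- ⅛)) ℚ.+ ⅛
          ≡⟨ ℚₚ.+-assoc (seq (K ·ᵣ 1ᵣ) j) (1ℚ ℚ.- ⅛) ⅛ ⟩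
        seq (K ·ᵣ 1ᵣ) j ℚ.+ 1ℚ
          ≡⟨ ℚₚ.+-comm (seq (K ·ᵣ 1ᵣ) j) 1ℚ ⟩
        seq (suc K ·ᵣ 1ᵣ) j
          ≡⟨ throughput-suc-K j ⟨
        seq (FractionalSolution.throughput (solution a k) (suc K)) j ∎)
        where open ≡-Reasoning

  code< : ∀ ω → code ω ℕ.< 6
  code< ω = Finₚ.toℕ<n (Fin.combine (proj₁ (scenario ω)) (proj₂ (scenario ω)))

  likely-code : ∃ λ i → i ℕ.< 6 × fromℚ ⅛ ≤ᵣ ℙ (λ ω → code ω ≡ i)
  likely-code = some-value-likely code-measurable 6 ⅛ η (from-yes (0ℚ ℚ.<? η)) code< six-small

  Beaten : Set
  Beaten = ∃ λ σ → ∃ λ (F : FractionalSolution B σ) →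
           expectedThroughput σ F ≺ FractionalSolution.throughput F

  beaten-in : ∀ a k → fromℚ ⅛ ≤ᵣ ℙ (λ ω → code ω ≡ toℕ (Fin.combine a k)) → Beaten
  beaten-in a k likely =
    input a k , solution a k , bound a k _ code≡⇒ likely , expected≤ a k _ code≡⇒ likely ,
    suc K , bound< a k _ code≡⇒ likely
    where
    code≡⇒ : ∀ ω → code ω ≡ toℕ (Fin.combine a k) → scenario ω ≡ (a , k)
    code≡⇒ ω c≡ =
      let a≡ , k≡ = Finₚ.combine-injective _ _ a k (Finₚ.toℕ-injective c≡)
      in cong₂ _,_ a≡ k≡

  beaten : Beaten
  beaten =
    let i , i<6 , likely = likely-code
        a , k , ak≡i     = Finₚ.combine-surjective {2} (Fin.fromℕ< i<6)
    in beaten-in a k (subst (λ j → fromℚ ⅛ ≤ᵣ ℙ (λ ω → code ω ≡ j))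
         (sym (trans (cong toℕ ak≡i) (Finₚ.toℕ-fromℕ< i<6))) likely)

theorem15 : ∀ (m B : ℕ) → 3 ≤ m → 1 ≤ B →
    ∀ (RAND : RoundingAlgorithm m) →
    ∃ λ (σ : Input m) →
    ∃ λ (FRAC : FractionalSolution B σ) →
    RoundingAlgorithm.expectedThroughput RAND σ FRAC ≺ FractionalSolution.throughput FRAC
theorem15 (suc (suc (suc m′))) (suc b) (s≤s (s≤s (s≤s _))) (s≤s _) RAND =
  Beating.beaten m′ b (N ℕ.∸ 2) (sym (ℕₚ.m+[n∸m]≡n 2≤N)) RAND
  where
  N : ℕ
  N = (3 ℕ.+ m′) ℕ.* suc b

  2≤N : 2 ℕ.≤ N
  2≤N = s≤s (ℕₚ.≤-trans (s≤s z≤n) (ℕₚ.m≤n+m _ b))
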